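{- Let $G$ be a plane signed graph in which some faces are marked as deadly, and let $d$ be the number of deadly faces. If $G$ contains an odd face and every odd face of $G$ is deadly, then $\tau(G)\le \nu_{\mathrm{dead}}(G)+2d-2$, where $\nu_{\mathrm{dead}}(G)$ is the maximum number of pairwise vertex-disjoint odd cycles of $G$ that are vertex-disjoint from (the boundaries of) all deadly faces.
   Context: A signed graph is a simple graph in which every edge is assigned a parity, odd or even. A cycle is odd if it contains an odd number of odd edges. A face of a plane signed graph is odd if its boundary contains an odd number of odd edges, where bridges on the boundary are counted twice; it is even otherwise. A set $S$ of vertices is a transversal if $G\setminus S$ has no odd cycle; $\tau(G)$ is the minimum size of a transversal. A cycle is vertex-disjoint from a face if it shares no vertex with the boundary of that face. -}

module Defs where

open import Data.Nat using (ℕ; zero; suc; _+_; _*_; _≤_)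
open import Data.Nat.DivMod using (_%_; _mod_)
open import Data.Fin using (Fin; zero; suc; toℕ; _≟_)
open import Data.Bool using (Bool; true; false; not; if_then_else_; _∨_)
open import Data.Product using (Σ; ∃; _×_; _,_; proj₁; proj₂)
open import Data.Sum using (_⊎_)
open import Relation.Nullary using (¬_)
open import Relation.Nullary.Decidable using (⌊_⌋)
open import Relation.Binary.PropositionalEquality using (_≡_; _≢_)
open import Function using (_∘_)

countF : ∀ {k} → (Fin k → Bool) → ℕ
countF {zero}  p = 0
countF {suc k} p = (if p zero then 1 else 0) + countF (p ∘ suc)

anyF : ∀ {k} → (Fin k → Bool) → Bool
anyF {zero}  p = false
anyF {suc k} p = p zero ∨ anyF (p ∘ suc)

iter : ∀ {A : Set} → (A → A) → ℕ → A → A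
iter f zero    x = x
iter f (suc k) x = f (iter f k x)

IsOdd : ℕ → Set
IsOdd k = k % 2 ≡ 1

record SignedGraph : Set where
  field
    n m   : ℕ
    end   : Fin m → Bool → Fin n
    odd   : Fin m → Bool
    noLoop  : ∀ e → end e false ≢ end e true
    noMulti : ∀ e e' → e ≢ e' →
              ¬ ((end e false ≡ end e' false × end e true ≡ end e' true)
               ⊎ (end e false ≡ end e' true  × end e true ≡ end e' false))

module _ (G : SignedGraph) where
  open SignedGraph G

  Joins : Fin m → Fin n → Fin n → Set
  Joins e u v = (end e false ≡ u × end e true ≡ v) ⊎ (end e false ≡ v × end e true ≡ u)

  record Cycle : Set where
    field
      l    : ℕ
      vs   : Fin (3 + l) → Fin n
      vsInj : ∀ i j → vs i ≡ vs j → i ≡ j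
      es   : Fin (3 + l) → Fin m
      join : ∀ i → Joins (es i) (vs i) (vs ((suc (toℕ i)) mod (3 + l)))

  OnCycle : Cycle → Fin n → Set
  OnCycle C v = ∃ λ i → Cycle.vs C i ≡ v

  OddCycle : Cycle → Set
  OddCycle C = IsOdd (countF (odd ∘ Cycle.es C))

  IsTransversal : (Fin n → Bool) → Set
  IsTransversal S = ∀ C → OddCycle C → ∃ λ v → OnCycle C v × S v ≡ true

  IsTau : ℕ → Set
  IsTau t = (∃ λ S → IsTransversal S × countF S ≡ t)
          × (∀ S → IsTransversal S → t ≤ countF S)

-- Plane signed graphs, encoded combinatorially.
-- Darts are (e , b): edge e traversed from (end e b) to (end e (not b)).
-- σ is the rotation system (cyclic order of darts around each vertex);
-- the face-tracing permutation is φ = σ ∘ α where α reverses a dart.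
-- The orbits of φ are the boundary walks of the components' faces,
-- labelled by walkOf : Dart → Fin W.  Each face of G (labelled Fin F)
-- is a set of such walks (faceOf) together with isolated vertices lying
-- in it (faceIso, only meaningful on isolated vertices).  The embedding
-- is in the plane iff every component is spherically embedded
-- (Euler: n - m + W + I = 2C, I = #isolated vertices) and the incidence
-- graph between components and faces is a tree
-- (connected with W + I + 1 = C + F).

record PlaneSignedGraph : Set where
  field
    graph : SignedGraph
  open SignedGraph graph public

  Dart : Set
  Dart = Fin m × Bool

  tail : Dart → Fin n
  tail (e , b) = end e b

  α : Dart → Dart
  α (e , b) = (e , not b)

  anyDart : (Dart → Bool) → Bool
  anyDart p = anyF (λ e → p (e , false)) ∨ anyF (λ e → p (e , true))

  countDart : (Dart → Bool) → ℕ
  countDart p = countF (λ e → p (e , false)) + countF (λ e → p (e , true))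

  isolatedB : Fin n → Bool
  isolatedB v = not (anyDart (λ d → ⌊ tail d ≟ v ⌋))

  field
    σ σ⁻¹   : Dart → Dart
    σσ⁻¹    : ∀ d → σ (σ⁻¹ d) ≡ d
    σ⁻¹σ    : ∀ d → σ⁻¹ (σ d) ≡ d
    σ-tail  : ∀ d → tail (σ d) ≡ tail d
    σ-cyclic : ∀ d d' → tail d ≡ tail d' → ∃ λ k → iter σ k d ≡ d'
  φ : Dart → Dart
  φ = σ ∘ α

  field
    C       : ℕ
    comp    : Fin n → Fin C
    comp-surj : ∀ c → ∃ λ v → comp v ≡ c
    comp-edge : ∀ e → comp (end e false) ≡ comp (end e true)
    comp-conn : ∀ (P : Fin n → Bool) → (∀ e → P (end e false) ≡ P (end e true)) →
                ∀ u v → comp u ≡ comp v → P u ≡ P v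
    W       : ℕ
    walkOf  : Dart → Fin W
    walk-surj : ∀ w → ∃ λ d → walkOf d ≡ w
    walk-φ  : ∀ d → walkOf (φ d) ≡ walkOf d
    walk-orbit : ∀ d d' → walkOf d ≡ walkOf d' → ∃ λ k → iter φ k d ≡ d'
    F       : ℕ
    faceOf  : Fin W → Fin F
    faceIso : Fin n → Fin F
    euler   : n + W + countF isolatedB ≡ 2 * C + m
    treeCount : W + countF isolatedB + 1 ≡ C + F
    treeConn : ∀ (P : Fin C ⊎ Fin F → Bool) →
               (∀ d → P (Data.Sum.inj₁ (comp (tail d))) ≡ P (Data.Sum.inj₂ (faceOf (walkOf d)))) →
               (∀ v → isolatedB v ≡ true →
                  P (Data.Sum.inj₁ (comp v)) ≡ P (Data.Sum.inj₂ (faceIso v))) →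
               ∀ x y → P x ≡ P y

  faceOfDart : Dart → Fin F
  faceOfDart d = faceOf (walkOf d)

  OnBoundary : Fin F → Fin n → Set
  OnBoundary f v = (∃ λ d → faceOfDart d ≡ f × tail d ≡ v)
                 ⊎ (isolatedB v ≡ true × faceIso v ≡ f)

  -- number of odd edges on the boundary of f, counted with multiplicity
  -- along the boundary walks (so bridges are counted twice)
  oddOnBoundary : Fin F → ℕ
  oddOnBoundary f = countDart (λ d → ⌊ faceOfDart d ≟ f ⌋ Data.Bool.∧ odd (proj₁ d))

  OddFace : Fin F → Set
  OddFace f = IsOdd (oddOnBoundary f)

  record DeadPacking (deadly : Fin F → Bool) : Set where
    field
      size    : ℕ
      cyc     : Fin size → Cycle graph
      cycOdd  : ∀ i → OddCycle graph (cyc i)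
      disjoint : ∀ i j → i ≢ j → ∀ v → OnCycle graph (cyc i) v → ¬ OnCycle graph (cyc j) v
      avoid   : ∀ i f → deadly f ≡ true → ∀ v → OnCycle graph (cyc i) v → ¬ OnBoundary f v

  IsNuDead : (Fin F → Bool) → ℕ → Set
  IsNuDead deadly k = (∃ λ (P : DeadPacking deadly) → DeadPacking.size P ≡ k)
                    × (∀ (P : DeadPacking deadly) → DeadPacking.size P ≤ k)

{-# OPTIONS --safe #-}

-- Call two faces linked when they share a vertex, and let T be the set of odd faces. A set of links
-- with boundary T modulo 2 (a T-join) gives a transversal of the same size: by Euler's formula an odd
-- cycle is the border of a set Z of faces with |Z ∩ T| odd, a T-join must leave Z, and it can do so
-- only through a vertex of the cycle. Conversely, if |Z ∩ T| is odd, then some odd cycle uses only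
-- vertices lying both on a face in Z and on a face outside Z. So it suffices to compare T-joins with
-- packings of T-odd cuts Z, by induction. If two deadly faces are at most two links apart, identify
-- them: a T-join loses at most 2 links and d drops by 1. Otherwise choose a and b ∈ T for which the
-- least join of T + a + b is as small as possible, and absorb into b all faces linked to it: the
-- least T-join loses at most 1 link, and the rim of the enlarged face is one more cut for the packing.

module Submission where

open import Defs
open import Algebra.Bundles using (CommutativeRing)
open import Data.Bool using (Bool; true; false; not; if_then_else_; _∧_; _∨_; _xor_)
open import Data.Bool.Properties using (xor-∧-commutativeRing; xor-same; xor-identityʳ; xor-comm; xor-assoc;
  not-involutive; not-distribˡ-xor; ¬-not; ∧-comm; ∧-assoc; ∧-zeroʳ; ∧-identityʳ; ∨-zeroʳ; ∧-distribˡ-xor; ∧-distribʳ-xor)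
  renaming (_≟_ to _≟ᵇ_)
open import Data.Bool.Solver using (module xor-∧-Solver)
open import Data.Empty using (⊥; ⊥-elim)
open import Data.Fin using (Fin; zero; suc; toℕ; fromℕ; inject₁; _≟_; _↑ˡ_; _↑ʳ_; splitAt; combine; finToFun; funToFin)
  renaming (join to joinFin)
open import Data.Fin.Permutation using (Permutation′; _⟨$⟩ʳ_; permutation)
open import Data.Fin.Properties using (any?; injective⇒≤; finToFun-funToFin; funToFin-finToFin; splitAt-↑ˡ; splitAt-↑ʳ;
  join-splitAt; toℕ<n; toℕ-fromℕ<; toℕ-fromℕ; toℕ-inject₁; toℕ-injective)
open import Data.List using (List; []; _∷_; _++_; length; map; mapMaybe; lookup)
open import Data.List.Properties using (length-++; length-map; length-mapMaybe; mapMaybe-++)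
open import Data.List.Relation.Binary.Permutation.Propositional using (_↭_; ↭-refl; ↭-trans; refl; prep; swap)
  renaming (trans to compose)
open import Data.List.Relation.Binary.Permutation.Propositional.Properties using (↭-length; mapMaybe-↭; map⁺)
open import Data.Maybe using (Maybe; just; nothing)
open import Data.Nat using (ℕ; zero; suc; _+_; _*_; _^_; _∸_; _≤_; _<_; _≤?_; z≤n; s≤s)
open import Data.Nat.DivMod using (_%_; _mod_; m<n⇒m%n≡m; n%n≡0; m%n<n)
import Data.Nat.ListAction as ℕ
import Data.Nat.ListAction.Properties as ℕ
open import Data.Nat.Properties hiding (_≟_; _≤?_)
open import Data.Nat.Solver using (module +-*-Solver)
open import Data.Product using (Σ; ∃; _×_; _,_; proj₁; proj₂)
open import Data.Sum using (_⊎_; inj₁; inj₂; [_,_]; isInj₁; isInj₂)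
open import Function using (_∘_)
open import Relation.Binary.PropositionalEquality as ≡ hiding ([_]; J)
open ≡ using () renaming (trans to _∙_)
open import Relation.Nullary using (¬_; Dec; yes; no)
open import Relation.Nullary.Decidable using (⌊_⌋; toSum; map′; _×-dec_; _⊎-dec_; ¬?; decidable-stable)
open import Algebra.Properties.Semiring.Sum (CommutativeRing.semiring xor-∧-commutativeRing)
  using (*-distribˡ-sum)
  renaming (sum to Σ₂; sum-cong-≗ to Σ₂-cong; ∑-distrib-+ to Σ₂-distrib; ∑-comm to Σ₂-comm;
    sum-permute to Σ₂-permute; sum-init-last to Σ₂-init-last)

-- The obstacle is lifting a join back out of the ball around `b`. The lifted join has odd degree at
-- stray faces of the ball, and linking each of them to `b` would cost one link apiece. The choice
-- of `a` and `b` limits this to one link in all: stray ends are paired by exchanging links with the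
-- shortest join of T + a + b, whose minimality bounds the cost of each pairing. Parity leaves one
-- end over; the extra terminal `a` takes it, and only this last pairing costs an additional link.
-- Deadly faces are recorded apart from T. Merging two odd faces removes both from T, yet the cuts
-- must still avoid the merged face.

δ : ∀ {k} → Fin k → Fin k → Bool
δ i j = ⌊ i ≟ j ⌋

δ-refl : ∀ {k} (i : Fin k) → δ i i ≡ true
δ-refl i with i ≟ i
... | yes _ = refl
... | no i≢i = ⊥-elim (i≢i refl)

δ-≢ : ∀ {k} {i j : Fin k} → i ≢ j → δ i j ≡ false
δ-≢ {i = i} {j} i≢j with i ≟ j
... | yes i≡j = ⊥-elim (i≢j i≡j)
... | no _ = refl

δ-true : ∀ {k} {i j : Fin k} → δ i j ≡ true → i ≡ j
δ-true {i = i} {j} p with i ≟ j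
... | yes i≡j = i≡j

δ-inj : ∀ {k l} (f : Fin k → Fin l) → (∀ {i j} → f i ≡ f j → i ≡ j) →
        ∀ i j → δ (f i) (f j) ≡ δ i j
δ-inj f inj i j with i ≟ j
... | yes refl = δ-refl (f i)
... | no i≢j = δ-≢ (i≢j ∘ inj)

δ-sym : ∀ {k} (i j : Fin k) → δ i j ≡ δ j i
δ-sym i j with i ≟ j
... | yes refl = sym (δ-refl i)
... | no i≢j = sym (δ-≢ (i≢j ∘ sym))

xor-cancel : ∀ {a b} → a xor b ≡ false → a ≡ b
xor-cancel {false} {false} _ = refl
xor-cancel {true} {true} _ = refl

xor-true : ∀ {a b} → a xor b ≡ true → a ≡ true ⊎ b ≡ true
xor-true {true} _ = inj₁ refl
xor-true {false} p = inj₂ p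

true≢false : ∀ {b} → b ≡ true → b ≡ false → ⊥
true≢false refl ()

-- The library's sum unfolds to a fold, which blocks inference of the summand; hence the opaque copy.
opaque
  sum : ∀ {k} → (Fin k → Bool) → Bool
  sum = Σ₂

  sum-[] : (f : Fin 0 → Bool) → sum f ≡ false
  sum-[] f = refl

  sum-suc : ∀ {k} (f : Fin (suc k) → Bool) → sum f ≡ f zero xor sum (f ∘ suc)
  sum-suc f = refl

  sum-cong : ∀ {k} {f g : Fin k → Bool} → f ≗ g → sum f ≡ sum g
  sum-cong = Σ₂-cong

  sum-distrib-xor : ∀ {k} (f g : Fin k → Bool) → sum (λ i → f i xor g i) ≡ sum f xor sum g
  sum-distrib-xor = Σ₂-distrib

  sum-comm : ∀ {k l} (f : Fin k → Fin l → Bool) → sum (λ i → sum (f i)) ≡ sum (λ j → sum λ i → f i j)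
  sum-comm = Σ₂-comm

  sum-permute : ∀ {k} (f : Fin k → Bool) (π : Permutation′ k) → sum (f ∘ (π ⟨$⟩ʳ_)) ≡ sum f
  sum-permute f π = sym (Σ₂-permute f π)

  sum-init-last : ∀ {k} (f : Fin (suc k) → Bool) → sum f ≡ sum (f ∘ inject₁) xor f (fromℕ k)
  sum-init-last = Σ₂-init-last

  ∧-distribˡ-sum : ∀ {k} a (f : Fin k → Bool) → sum (λ i → a ∧ f i) ≡ a ∧ sum f
  ∧-distribˡ-sum a f = sym (*-distribˡ-sum a f)

sum-zero : ∀ {k} {f : Fin k → Bool} → (∀ i → f i ≡ false) → sum f ≡ false
sum-zero {zero} p = sum-[] _
sum-zero {suc k} p = trans (sum-suc _) (cong₂ _xor_ (p zero) (sum-zero (p ∘ suc)))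

sum-↑ : ∀ k {l} (f : Fin (k + l) → Bool) → sum f ≡ sum (f ∘ (_↑ˡ l)) xor sum (f ∘ (k ↑ʳ_))
sum-↑ zero f = cong (_xor sum f) (sym (sum-[] _))
sum-↑ (suc k) {l} f = begin
  sum f                                                       ≡⟨ sum-suc f ⟩
  f zero xor sum (f ∘ suc)                                    ≡⟨ cong (f zero xor_) (sum-↑ k (f ∘ suc)) ⟩
  f zero xor (sum (f ∘ suc ∘ (_↑ˡ l)) xor sum (f ∘ (suc k ↑ʳ_)))  ≡⟨ sym (xor-assoc (f zero) _ _) ⟩
  (f zero xor sum (f ∘ suc ∘ (_↑ˡ l))) xor sum (f ∘ (suc k ↑ʳ_))
    ≡⟨ cong (_xor sum (f ∘ (suc k ↑ʳ_))) (sym (sum-suc (f ∘ (_↑ˡ l)))) ⟩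
  sum (f ∘ (_↑ˡ l)) xor sum (f ∘ (suc k ↑ʳ_))                 ∎
  where open ≡-Reasoning

sum-true : ∀ {k} (f : Fin k → Bool) → sum f ≡ true → ∃ λ i → f i ≡ true
sum-true f p with any? (λ i → f i ≟ᵇ true)
... | yes q = q
... | no none = ⊥-elim (true≢false p (sum-zero λ i → ¬-not λ q → none (i , q)))

sum-δ : ∀ {k} (i : Fin k) (f : Fin k → Bool) → sum (λ j → δ i j ∧ f j) ≡ f i
sum-δ zero f = trans (sum-suc _) (trans (cong (f zero xor_) (sum-zero λ _ → refl)) (xor-identityʳ _))
sum-δ (suc i) f = trans (sum-suc _)
  (trans (sum-cong λ j → cong (_∧ f (suc j)) (δ-inj suc (λ { refl → refl }) i j)) (sum-δ i (f ∘ suc)))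

infix 7 _·_
_·_ : ∀ {k} → (Fin k → Bool) → (Fin k → Bool) → Bool
f · g = sum λ i → f i ∧ g i

_⊞_ : ∀ {k} → (Fin k → Bool) → (Fin k → Bool) → Fin k → Bool
(f ⊞ g) i = f i xor g i

·-cong : ∀ {k} {f f' g g' : Fin k → Bool} → f ≗ f' → g ≗ g' → f · g ≡ f' · g'
·-cong p q = sum-cong λ i → cong₂ _∧_ (p i) (q i)

·-comm : ∀ {k} (f g : Fin k → Bool) → f · g ≡ g · f
·-comm f g = sum-cong λ i → ∧-comm (f i) (g i)

·-distribˡ : ∀ {k} (f g h : Fin k → Bool) → f · (g ⊞ h) ≡ f · g xor f · h
·-distribˡ f g h = trans (sum-cong λ i → ∧-distribˡ-xor (f i) (g i) (h i)) (sum-distrib-xor _ _)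

·-distribʳ : ∀ {k} (f g h : Fin k → Bool) → (g ⊞ h) · f ≡ g · f xor h · f
·-distribʳ f g h = trans (·-comm (g ⊞ h) f) (trans (·-distribˡ f g h) (cong₂ _xor_ (·-comm f g) (·-comm f h)))

-- Linear algebra over the field with two elements.

lin : ∀ {a b} → (Fin b → Fin a → Bool) → (Fin b → Bool) → Fin a → Bool
lin M x i = sum λ k → x k ∧ M k i

·-lin : ∀ {a b} (M : Fin b → Fin a → Bool) (x : Fin b → Bool) (y : Fin a → Bool) →
        y · lin M x ≡ x · (λ k → y · M k)
·-lin M x y = begin
  sum (λ i → y i ∧ sum (λ k → x k ∧ M k i))    ≡⟨ sum-cong (λ i → sym (∧-distribˡ-sum (y i) _)) ⟩
  sum (λ i → sum (λ k → y i ∧ (x k ∧ M k i)))  ≡⟨ sum-comm _ ⟩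
  sum (λ k → sum (λ i → y i ∧ (x k ∧ M k i)))
    ≡⟨ sum-cong (λ k → trans (sum-cong λ i → swap∧ (y i) (x k) (M k i)) (∧-distribˡ-sum (x k) _)) ⟩
  sum (λ k → x k ∧ sum (λ i → y i ∧ M k i))    ∎
  where
  open ≡-Reasoning
  swap∧ : ∀ a b c → a ∧ (b ∧ c) ≡ b ∧ (a ∧ c)
  swap∧ a b c = trans (sym (∧-assoc a b c)) (trans (cong (_∧ c) (∧-comm a b)) (∧-assoc b a c))

Solution : ∀ {a b} → (Fin b → Fin a → Bool) → (Fin a → Bool) → Set
Solution M c = ∃ λ x → ∀ i → lin M x i ≡ c i

Obstruction : ∀ {a b} → (Fin b → Fin a → Bool) → (Fin a → Bool) → Set
Obstruction M c = ∃ λ y → (∀ k → y · M k ≡ false) × y · c ≡ true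

cons : ∀ {A : Set} {k} → A → (Fin k → A) → Fin (suc k) → A
cons a f zero = a
cons a f (suc i) = f i

-- Elimination of one row at a time. An obstruction y for the remaining rows either kills the first
-- row too or pairs to 1 with it. In the latter case `c` plus the first row is tried; if that yields
-- a second obstruction pairing to 1 with the first row, the sum of the two obstructions kills every
-- row.
fredholm : ∀ {a b} (M : Fin b → Fin a → Bool) (c : Fin a → Bool) → Solution M c ⊎ Obstruction M c
fredholm {a} {zero} M c with any? (λ i → c i ≟ᵇ true)
... | yes (i , ci) = inj₂ (δ i , (λ ()) , trans (sum-δ i c) ci)
... | no none = inj₁ ((λ ()) , λ i → trans (sum-[] _) (sym (¬-not (λ p → none (i , p)))))
fredholm {a} {suc b} M c with fredholm (M ∘ suc) c
... | inj₁ (x , p) = inj₁ (cons false x , λ i → trans (sum-suc _) (p i))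
... | inj₂ (y , y⊥ , yc) with y · M zero in y₀
...   | false = inj₂ (y , (λ { zero → y₀ ; (suc k) → y⊥ k }) , yc)
...   | true with fredholm (M ∘ suc) (c ⊞ M zero)
...     | inj₁ (x , p) = inj₁ (cons true x , λ i →
                    trans (sum-suc _) (trans (cong (M zero i xor_) (p i)) (lemma (M zero i) (c i))))
  where
  open xor-∧-Solver
  lemma : ∀ m c → m xor (c xor m) ≡ c
  lemma = solve 2 (λ m c → m :+ (c :+ m) := c) refl
...     | inj₂ (y' , y'⊥ , y'c) with y' · M zero in y'₀
...       | false = inj₂ (y' , (λ { zero → y'₀ ; (suc k) → y'⊥ k }) ,
                      trans (sym (trans (·-distribˡ y' c (M zero)) (trans (cong (y' · c xor_) y'₀) (xor-identityʳ _)))) y'c)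
...       | true = inj₂ (y ⊞ y' , (λ { zero → trans (·-distribʳ (M zero) y y') (cong₂ _xor_ y₀ y'₀)
                                     ; (suc k) → trans (·-distribʳ (M (suc k)) y y') (cong₂ _xor_ (y⊥ k) (y'⊥ k)) }) ,
                   trans (·-distribʳ c y y') (cong₂ _xor_ yc y'c≡false))
  where
  y'c≡false : y' · c ≡ false
  y'c≡false = lemma (trans (sym (trans (·-distribˡ y' c (M zero)) (cong (y' · c xor_) y'₀))) y'c)
    where
    lemma : ∀ {b} → b xor true ≡ true → b ≡ false
    lemma {false} _ = refl

private
  toBool : Fin 2 → Bool
  toBool zero = false
  toBool (suc zero) = true

  fromBool : Bool → Fin 2
  fromBool false = zero
  fromBool true = suc zero

  toBool-fromBool : ∀ b → toBool (fromBool b) ≡ b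
  toBool-fromBool false = refl
  toBool-fromBool true = refl

  toBool-injective : ∀ {i j} → toBool i ≡ toBool j → i ≡ j
  toBool-injective {zero} {zero} _ = refl
  toBool-injective {zero} {suc zero} ()
  toBool-injective {suc zero} {zero} ()
  toBool-injective {suc zero} {suc zero} _ = refl

funToFin-cong : ∀ {k l} {f g : Fin k → Fin l} → f ≗ g → funToFin f ≡ funToFin g
funToFin-cong {zero} p = refl
funToFin-cong {suc k} p = cong₂ combine (p zero) (funToFin-cong (p ∘ suc))

encode : ∀ {k} → (Fin k → Bool) → Fin (2 ^ k)
encode f = funToFin (fromBool ∘ f)

decode : ∀ {k} → Fin (2 ^ k) → Fin k → Bool
decode c = toBool ∘ finToFun c

decode-encode : ∀ {k} (f : Fin k → Bool) → decode (encode f) ≗ f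
decode-encode f i = trans (cong toBool (finToFun-funToFin (fromBool ∘ f) i)) (toBool-fromBool (f i))

encode-cong : ∀ {k} {f g : Fin k → Bool} → f ≗ g → encode f ≡ encode g
encode-cong p = funToFin-cong (cong fromBool ∘ p)

encode-injective : ∀ {k} {f g : Fin k → Bool} → encode f ≡ encode g → f ≗ g
encode-injective {f = f} {g} p i =
  trans (sym (decode-encode f i)) (trans (cong (λ c → decode c i) p) (decode-encode g i))

decode-injective : ∀ {k} {c d : Fin (2 ^ k)} → decode {k} c ≗ decode d → c ≡ d
decode-injective {k} {c} {d} p =
  trans (sym (funToFin-finToFin {k} c)) (trans (funToFin-cong (toBool-injective ∘ p)) (funToFin-finToFin {k} d))

-- Pigeonhole on the 2^a vectors takes the place of bases and ranks, so `Φ` need not be linear.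
-- Pointwise equality keeps function extensionality out.
dimension-≤ : ∀ {a b} (Φ : (Fin a → Bool) → Fin b → Bool) → (∀ x x' → Φ x ≗ Φ x' → x ≗ x') → a ≤ b
dimension-≤ {a} {b} Φ inj with a ≤? b
... | yes a≤b = a≤b
... | no a≰b = ⊥-elim (<⇒≱ (^-monoʳ-< 2 (s≤s (s≤s z≤n)) (≰⇒> a≰b))
        (injective⇒≤ {f = encode ∘ Φ ∘ decode} λ p → decode-injective (inj _ _ (encode-injective p))))

-- Edge lists modulo 2, trails, and exchange of edges between two lists.

module _ {E : Set} where

  xorSum : (E → Bool) → List E → Bool
  xorSum f [] = false
  xorSum f (e ∷ L) = f e xor xorSum f L

  xorSum-cong : ∀ {f g : E → Bool} → f ≗ g → xorSum f ≗ xorSum g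
  xorSum-cong p [] = refl
  xorSum-cong p (e ∷ L) = cong₂ _xor_ (p e) (xorSum-cong p L)

  xorSum-++ : ∀ f (L M : List E) → xorSum f (L ++ M) ≡ xorSum f L xor xorSum f M
  xorSum-++ f [] M = refl
  xorSum-++ f (e ∷ L) M = cong (f e xor_) (xorSum-++ f L M) ∙ sym (xor-assoc (f e) _ _)

  xorSum-↭ : ∀ f {L M : List E} → L ↭ M → xorSum f L ≡ xorSum f M
  xorSum-↭ f refl = refl
  xorSum-↭ f (prep e p) = cong (f e xor_) (xorSum-↭ f p)
  xorSum-↭ f (swap {xs = L} {M} d e p) = cong (λ b → f d xor (f e xor b)) (xorSum-↭ f p) ∙ lemma (f d) (f e) (xorSum f M)
    where
    open xor-∧-Solver
    lemma : ∀ a b c → a xor (b xor c) ≡ b xor (a xor c)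
    lemma = solve 3 (λ a b c → a :+ (b :+ c) := b :+ (a :+ c)) refl
  xorSum-↭ f (compose p q) = xorSum-↭ f p ∙ xorSum-↭ f q

  xorSum-true : ∀ f (L : List E) → xorSum f L ≡ true → ∃ λ e → ∃ λ L' → f e ≡ true × L ↭ e ∷ L'
  xorSum-true f (e ∷ L) p with f e in eq
  ... | true = e , L , eq , ↭-refl
  ... | false = let d , L' , fd , q = xorSum-true f L p in
                d , e ∷ L' , fd , ↭-trans (prep e q) (swap e d ↭-refl)

  xorSum-zero : ∀ {f} → (∀ e → f e ≡ false) → (L : List E) → xorSum f L ≡ false
  xorSum-zero p [] = refl
  xorSum-zero p (e ∷ L) = cong₂ _xor_ (p e) (xorSum-zero p L)

  sum-xorSum : ∀ {k} (z : Fin k → Bool) (f : E → Fin k → Bool) (L : List E) →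
               z · (λ i → xorSum (λ e → f e i) L) ≡ xorSum (λ e → z · f e) L
  sum-xorSum z f [] = sum-zero λ i → ∧-zeroʳ (z i)
  sum-xorSum z f (e ∷ L) = ·-distribˡ z (f e) _ ∙ cong (z · f e xor_) (sum-xorSum z f L)

module Trails {k : ℕ} {E : Set} (s t : E → Fin k) (s≢t : ∀ e → s e ≢ t e) where

  ends : Fin k → E → Bool
  ends v e = δ v (s e) xor δ v (t e)

  boundary : List E → Fin k → Bool
  boundary L v = xorSum (ends v) L

  boundary-++ : ∀ L M v → boundary (L ++ M) v ≡ boundary L v xor boundary M v
  boundary-++ L M v = xorSum-++ _ L M

  boundary-↭ : ∀ {L M} → L ↭ M → ∀ v → boundary L v ≡ boundary M v
  boundary-↭ p v = xorSum-↭ _ p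

  Joined : E → Fin k → Fin k → Set
  Joined e x y = (s e ≡ x × t e ≡ y) ⊎ (s e ≡ y × t e ≡ x)

  data Trail : Fin k → List E → Fin k → Set where
    []   : ∀ {x} → Trail x [] x
    step : ∀ {x x' y e L} → Joined e x x' → Trail x' L y → Trail x (e ∷ L) y

  ends-Joined : ∀ {e x y} → Joined e x y → ∀ v → ends v e ≡ δ v x xor δ v y
  ends-Joined (inj₁ (refl , refl)) v = refl
  ends-Joined {e} (inj₂ (refl , refl)) v = xor-comm (δ v (s e)) _

  boundary-Trail : ∀ {x L y} → Trail x L y → ∀ v → boundary L v ≡ δ v x xor δ v y
  boundary-Trail {x} [] v = sym (xor-same (δ v x))
  boundary-Trail {y = y} (step {x} {x'} j w) v =
    cong₂ _xor_ (ends-Joined j v) (boundary-Trail w v) ∙ lemma (δ v x) (δ v x') (δ v y)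
    where
    open xor-∧-Solver
    lemma : ∀ a b c → (a xor b) xor (b xor c) ≡ a xor c
    lemma = solve 3 (λ a b c → (a :+ b) :+ (b :+ c) := a :+ c) refl

  OddTrail : List E → Fin k → Set
  OddTrail L x = ∃ λ y → y ≢ x × boundary L y ≡ true × ∃ λ X → ∃ λ R → Trail x X y × L ↭ X ++ R

  -- Follow unused edges from an odd vertex until another odd vertex is met.
  extractTrail : ∀ L x → boundary L x ≡ true → OddTrail L x
  extractTrail L = go (length L) L ≤-refl
    where
    go : ∀ n L → length L ≤ n → ∀ x → boundary L x ≡ true → OddTrail L x

    follow : ∀ n L {L'} → length L ≤ suc n → ∀ e x x' → L ↭ e ∷ L' → x ≢ x' →
             Joined e x x' → boundary L x ≡ true → OddTrail L x
    follow n L {L'} len e x x' p x≢x' j odd with boundary L x' in eq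
    ... | true = x' , x≢x' ∘ sym , eq , e ∷ [] , L' , step j [] , p
    ... | false =
      let y , y≢x' , oddy , X , R , w , q = go n L' (≤-pred (≤-trans (≤-reflexive (sym (↭-length p))) len)) x' oddx'
          y≢x : y ≢ x
          y≢x = λ y≡x → true≢false (cong (boundary L') (sym y≡x) ∙ oddy) evenx
      in y , y≢x , (split y ∙ cong₂ _xor_ (cong₂ _xor_ (δ-≢ y≢x) (δ-≢ y≢x')) oddy) ,
         e ∷ X , R , step j w , ↭-trans p (prep e q)
      where
      split : ∀ v → boundary L v ≡ (δ v x xor δ v x') xor boundary L' v
      split v = boundary-↭ p v ∙ cong (_xor boundary L' v) (ends-Joined j v)

      flip : ∀ {a b c} → a ≡ b xor c → b ≡ true → c ≡ not a
      flip {c = false} refl refl = refl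
      flip {c = true} refl refl = refl

      oddx' : boundary L' x' ≡ true
      oddx' = flip (split x') (cong₂ _xor_ (δ-≢ (x≢x' ∘ sym)) (δ-refl x')) ∙ cong not eq

      -- Removing the edge uses up the odd degree of `x`, so the continued trail cannot end there.
      evenx : boundary L' x ≡ false
      evenx = flip (split x) (cong₂ _xor_ (δ-refl x) (δ-≢ x≢x')) ∙ cong not odd

    go zero [] _ x ()
    go (suc n) L len x odd with xorSum-true _ L odd
    ... | e , L' , here , p with xor-true here
    ...   | inj₁ q with refl ← δ-true {i = x} {s e} q = follow n L len e (s e) (t e) p (s≢t e) (inj₁ (refl , refl)) odd
    ...   | inj₂ q with refl ← δ-true {i = x} {t e} q = follow n L len e (t e) (s e) p (s≢t e ∘ sym) (inj₂ (refl , refl)) odd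

module Exchange {k : ℕ} {E : Set} (s t : E → Fin k) (s≢t : ∀ e → s e ≢ t e) where

  open Trails s t s≢t using (ends; boundary; boundary-++; boundary-↭) public
  private module Both = Trails {E = E ⊎ E} [ s , s ] [ t , t ] [ s≢t , s≢t ]

  private
    lefts rights : List (E ⊎ E) → List E
    lefts = mapMaybe isInj₁
    rights = mapMaybe isInj₂

    lefts-map : ∀ L M → lefts (map inj₁ L ++ map inj₂ M) ≡ L
    lefts-map [] [] = refl
    lefts-map [] (_ ∷ M) = lefts-map [] M
    lefts-map (e ∷ L) M = cong (e ∷_) (lefts-map L M)

    rights-map : ∀ L M → rights (map inj₁ L ++ map inj₂ M) ≡ M
    rights-map [] [] = refl
    rights-map [] (e ∷ M) = cong (e ∷_) (rights-map [] M)
    rights-map (_ ∷ L) M = rights-map L M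

    length-lefts-rights : ∀ L → length (lefts L) + length (rights L) ≡ length L
    length-lefts-rights [] = refl
    length-lefts-rights (inj₁ _ ∷ L) = cong suc (length-lefts-rights L)
    length-lefts-rights (inj₂ _ ∷ L) = +-suc _ _ ∙ cong suc (length-lefts-rights L)

    boundary-lefts-rights : ∀ L v → boundary (lefts L) v xor boundary (rights L) v ≡ Both.boundary L v
    boundary-lefts-rights [] v = refl
    boundary-lefts-rights (inj₁ e ∷ L) v = xor-assoc (ends v e) _ _ ∙ cong (ends v e xor_) (boundary-lefts-rights L v)
    boundary-lefts-rights (inj₂ e ∷ L) v =
      lemma (boundary (lefts L) v) (ends v e) _ ∙ cong (ends v e xor_) (boundary-lefts-rights L v)
      where
      open xor-∧-Solver
      lemma : ∀ a b c → a xor (b xor c) ≡ b xor (a xor c)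
      lemma = solve 3 (λ a b c → a :+ (b :+ c) := b :+ (a :+ c)) refl

    total : ∀ L M v → boundary L v xor boundary M v ≡ Both.boundary (map inj₁ L ++ map inj₂ M) v
    total L M v = cong₂ (λ L M → boundary L v xor boundary M v) (sym (lefts-map L M)) (sym (rights-map L M))
                  ∙ boundary-lefts-rights (map inj₁ L ++ map inj₂ M) v

  Exchanged : List E → List E → Fin k → Set
  Exchanged J₀ J₁ x =
    ∃ λ y → y ≢ x × boundary J₀ y xor boundary J₁ y ≡ true × ∃ λ J₀' → ∃ λ J₁' →
      (∀ v → boundary J₀' v ≡ boundary J₀ v xor (δ v x xor δ v y)) ×
      (∀ v → boundary J₁' v ≡ boundary J₁ v xor (δ v x xor δ v y)) ×
      length J₀' + length J₁' ≡ length J₀ + length J₁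

  -- Symmetric difference argument with repetitions allowed: tag each edge with the list it comes
  -- from, take a trail between two odd vertices of the union, and let its edges change lists. Both
  -- boundaries move by the two ends of the trail, and no edge is gained or lost.
  exchange : ∀ J₀ J₁ x → boundary J₀ x xor boundary J₁ x ≡ true → Exchanged J₀ J₁ x
  exchange J₀ J₁ x odd with Both.extractTrail (map inj₁ J₀ ++ map inj₂ J₁) x (sym (total J₀ J₁ x) ∙ odd)
  ... | y , y≢x , oddy , X , R , w , p = y , y≢x , (total J₀ J₁ y ∙ oddy) , lefts R ++ rights X , rights R ++ lefts X ,
        (λ v → boundary-++ (lefts R) (rights X) v ∙
                 lemma _ (boundary (lefts X) v) (boundary (lefts R) v) (boundary (rights X) v) _ (∂₀ v) (∂X v)) ,
        (λ v → boundary-++ (rights R) (lefts X) v ∙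
                 lemma _ (boundary (rights X) v) (boundary (rights R) v) (boundary (lefts X) v) _ (∂₁ v)
                       (xor-comm (boundary (rights X) v) _ ∙ ∂X v)) ,
        len
    where
    p₀ : J₀ ↭ lefts X ++ lefts R
    p₀ = subst₂ _↭_ (lefts-map J₀ J₁) (mapMaybe-++ isInj₁ X R) (mapMaybe-↭ isInj₁ p)

    p₁ : J₁ ↭ rights X ++ rights R
    p₁ = subst₂ _↭_ (rights-map J₀ J₁) (mapMaybe-++ isInj₂ X R) (mapMaybe-↭ isInj₂ p)

    ∂₀ : ∀ v → boundary J₀ v ≡ boundary (lefts X) v xor boundary (lefts R) v
    ∂₀ v = boundary-↭ p₀ v ∙ boundary-++ (lefts X) (lefts R) v

    ∂₁ : ∀ v → boundary J₁ v ≡ boundary (rights X) v xor boundary (rights R) v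
    ∂₁ v = boundary-↭ p₁ v ∙ boundary-++ (rights X) (rights R) v

    ∂X : ∀ v → boundary (lefts X) v xor boundary (rights X) v ≡ δ v x xor δ v y
    ∂X v = boundary-lefts-rights X v ∙ Both.boundary-Trail w v

    lemma : ∀ j a r b d → j ≡ a xor r → a xor b ≡ d → r xor b ≡ j xor d
    lemma j a r b d refl refl = solve 3 (λ a r b → r :+ b := (a :+ r) :+ (a :+ b)) refl a r b
      where open xor-∧-Solver

    len : length (lefts R ++ rights X) + length (rights R ++ lefts X) ≡ length J₀ + length J₁
    len = begin
      length (lefts R ++ rights X) + length (rights R ++ lefts X)
        ≡⟨ cong₂ _+_ (length-++ (lefts R)) (length-++ (rights R)) ⟩
      (length (lefts R) + length (rights X)) + (length (rights R) + length (lefts X))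
        ≡⟨ arith (length (lefts R)) (length (rights X)) (length (rights R)) (length (lefts X)) ⟩
      (length (lefts X) + length (lefts R)) + (length (rights X) + length (rights R))
        ≡⟨ cong₂ _+_ (sym (↭-length p₀ ∙ length-++ (lefts X))) (sym (↭-length p₁ ∙ length-++ (rights X))) ⟩
      length J₀ + length J₁ ∎
      where
      open ≡-Reasoning
      open +-*-Solver
      arith : ∀ a b c d → (a + b) + (c + d) ≡ (d + a) + (b + c)
      arith = solve 4 (λ a b c d → (a :+ b) :+ (c :+ d) := (d :+ a) :+ (b :+ c)) refl

cancel : ∀ a b → a xor (a xor b) ≡ b
cancel a b = sym (xor-assoc a a b) ∙ cong (_xor b) (xor-same a)

·-δ : ∀ {k} (z : Fin k → Bool) i → z · (λ v → δ v i) ≡ z i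
·-δ z i = ·-comm z _ ∙ (·-cong (λ v → δ-sym v i) (λ _ → refl) ∙ sum-δ i z)

sum-δ-true : ∀ {k} (i : Fin k) → sum (λ v → δ v i) ≡ true
sum-δ-true i = ·-δ (λ _ → true) i

module _ {k : ℕ} {E : Set} (f : E → Fin k) where

  atParity : List E → Fin k → Bool
  atParity W v = xorSum (λ r → δ v (f r)) W

  takeAt : ∀ W v → atParity W v ≡ true → ∃ λ r → ∃ λ W' → v ≡ f r × W ↭ r ∷ W'
  takeAt W v p = let r , W' , q , π = xorSum-true _ W p in r , W' , δ-true q , π

  atParity-↭ : ∀ {W r W'} → W ↭ r ∷ W' → ∀ v → atParity W v ≡ δ v (f r) xor atParity W' v
  atParity-↭ p v = xorSum-↭ _ p

  dropPair : ∀ r W → atParity W (f r) ≡ true →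
             ∃ λ r' → ∃ λ W' → W ↭ r' ∷ W' × ∀ v → atParity (r ∷ W) v ≡ atParity W' v
  dropPair r W p with takeAt W (f r) p
  ... | r' , W' , q , π = r' , W' , π , λ v →
        cong₂ _xor_ (cong (δ v) q) (atParity-↭ π v) ∙ cancel (δ v (f r')) (atParity W' v)

-- Links between faces, and the cost of lifting a join.

module Incidence {K N : ℕ} (A : Fin K → Fin N → Set) where

  -- The shared vertex is part of the link because the vertices `via` of a join will form the
  -- transversal.
  record Link : Set where
    constructor link
    field
      left right : Fin K
      apart      : left ≢ right
      via        : Fin N
      on-left    : A left via
      on-right   : A right via

  open Link public

  open Exchange left right apart public
  open Trails left right apart public using (Trail; []; step; OddTrail; extractTrail; boundary-Trail)

  ·-boundary : ∀ z J → z · boundary J ≡ xorSum (λ e → z (left e) xor z (right e)) J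
  ·-boundary z J = sum-xorSum z (λ e v → ends v e) J ∙
    xorSum-cong (λ e → ·-distribˡ z (λ v → δ v (left e)) _ ∙ cong₂ _xor_ (·-δ z (left e)) (·-δ z (right e))) J

  boundary-even : ∀ J → sum (boundary J) ≡ false
  boundary-even J = ·-boundary (λ _ → true) J ∙ xorSum-zero (λ _ → refl) J

  IsJoin : (Fin K → Bool) → List Link → Set
  IsJoin S J = ∀ v → boundary J v ≡ S v

  -- Let p be the least size of a join of T + a + b over all a and all b ∈ T, attained at J₀, and j
  -- the least size of a T-join. An arm stands for a neighbour of b at which a join arrives from a
  -- second terminal; exchanging links with J₀ re-pairs the arms, and minimality of p pays for it.
  module Shrinking (T : Fin K → Bool) (a b : Fin K) (Tb : T b ≡ true)
    (J₀ : List Link) (∂J₀ : IsJoin (λ v → T v xor (δ v a xor δ v b)) J₀)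
    (J₀-min : ∀ a' b' J → T b' ≡ true → IsJoin (λ v → T v xor (δ v a' xor δ v b')) J → length J₀ ≤ length J)
    (j : ℕ) (j-min : ∀ J → IsJoin T J → j ≤ length J) (T-even : sum T ≡ false) where

    open xor-∧-Solver

    record Arm : Set where
      constructor arm
      field
        tip     : Fin K
        tip∈T   : T tip ≡ true
        -- Number of links taken from the join to build the arm; the path has one more, the rim link
        -- at `b`.
        slack   : ℕ
        slack>0 : 1 ≤ slack
        path    : List Link
        ∂path   : IsJoin (λ v → δ v b xor δ v tip) path
        short   : length path ≤ suc slack
    open Arm

    record Spoke : Set where
      constructor spoke
      field
        foot   : Fin K
        foot∉T : T foot ≡ false
        rim    : Link
        ∂rim   : ∀ v → ends v rim ≡ δ v b xor δ v foot
    open Spoke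

    arms : List Arm → Fin K → Bool
    arms = atParity tip

    spokes : List Spoke → Fin K → Bool
    spokes = atParity foot

    cost : List Arm → ℕ
    cost W = ℕ.sum (map slack W)

    cost-↭ : ∀ {W r W'} → W ↭ r ∷ W' → cost W ≡ slack r + cost W'
    cost-↭ p = ℕ.sum-↭ (map⁺ slack p)

    length-tail : ∀ {E : Set} {n} {L L' : List E} {e} → L ↭ e ∷ L' → length L ≤ n → length L' ≤ n
    length-tail p len = ≤-trans (n≤1+n _) (≤-trans (≤-reflexive (sym (↭-length p))) len)

    -- Arithmetic common to the exchanges: x and y are the lengths after the exchange, p₀ and m
    -- those before. One exchanged join is completed by the path of an arm, of length π, the other
    -- is treated by recursion with remaining cost c.
    budget : ∀ {p q p₀ x y π l c m} → p ≤ x + π → π ≤ suc l → q ≤ y + c → x + y ≡ p₀ + m →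
             p + q ≤ p₀ + suc (m + (l + c))
    budget {p} {q} {p₀} {x} {y} {π} {l} {c} {m} h₁ h₂ h₃ h₄ = begin
      p + q                   ≤⟨ +-mono-≤ (≤-trans h₁ (+-monoʳ-≤ x h₂)) h₃ ⟩
      (x + suc l) + (y + c)   ≡⟨ arith₁ x l y c ⟩
      (x + y) + suc (l + c)   ≡⟨ cong (_+ suc (l + c)) h₄ ⟩
      (p₀ + m) + suc (l + c)  ≡⟨ arith₂ p₀ m (l + c) ⟩
      p₀ + suc (m + (l + c))  ∎
      where
      open ≤-Reasoning
      open +-*-Solver using () renaming (solve to solveℕ; _:+_ to _⊕_; _:=_ to _⊜_; con to conℕ)
      arith₁ : ∀ x l y c → (x + suc l) + (y + c) ≡ (x + y) + suc (l + c)
      arith₁ = solveℕ 4 (λ x l y c → (x ⊕ (conℕ 1 ⊕ l)) ⊕ (y ⊕ c) ⊜ (x ⊕ y) ⊕ (conℕ 1 ⊕ (l ⊕ c))) refl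
      arith₂ : ∀ p m s → (p + m) + suc s ≡ p + suc (m + s)
      arith₂ = solveℕ 3 (λ p m s → (p ⊕ m) ⊕ (conℕ 1 ⊕ s) ⊜ p ⊕ (conℕ 1 ⊕ (m ⊕ s))) refl

    suc-slack : ∀ {m l l' c} → 1 ≤ l' → suc (m + (l + c)) ≤ m + (l + (l' + c))
    suc-slack {m} {l} {l'} {c} h =
      ≤-trans (≤-reflexive (sym (+-suc m (l + c))))
              (+-monoʳ-≤ m (≤-trans (≤-reflexive (sym (+-suc l c))) (+-monoʳ-≤ l (+-monoˡ-≤ c h))))

    cost-tail : ∀ {W r' W'} → W ↭ r' ∷ W' → cost W' ≤ cost W
    cost-tail {W' = W'} p = ≤-trans (m≤n+m (cost W') _) (≤-reflexive (sym (cost-↭ p)))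

    dropEnds : ∀ s t y w → (s xor (t xor (y xor w))) xor (t xor y) ≡ s xor w
    dropEnds = solve 4 (λ s t y w → (s :+ (t :+ (y :+ w))) :+ (t :+ y) := s :+ w) refl

    -- The path of the arm moves the terminal `b` to y. Since y is in T, the result is a join of T +
    -- a + y and competes with `J₀`; this is why `J₀` is minimal over all terminals in T and not for
    -- `b` alone.
    J₀-rerouted : ∀ r y J₀' → T y ≡ true →
      (∀ v → boundary J₀' v ≡ boundary J₀ v xor (δ v (tip r) xor δ v y)) →
      length J₀ ≤ length J₀' + length (path r)
    J₀-rerouted r y J₀' Ty ∂J₀' = ≤-trans
      (J₀-min a y (J₀' ++ path r) Ty λ v →
        boundary-++ J₀' (path r) v ∙
        (cong₂ _xor_ (∂J₀' v ∙ cong (_xor (δ v (tip r) xor δ v y)) (∂J₀ v)) (∂path r v) ∙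
         lemma (T v) (δ v a) (δ v b) (δ v (tip r)) (δ v y)))
      (≤-reflexive (length-++ J₀'))
      where
      lemma : ∀ T a b t y → ((T xor (a xor b)) xor (t xor y)) xor (b xor t) ≡ T xor (a xor y)
      lemma = solve 5 (λ T a b t y → ((T :+ (a :+ b)) :+ (t :+ y)) :+ (b :+ t) := T :+ (a :+ y)) refl

    -- Arms with equal tips cancel. Otherwise `J₀` and `J` differ at the tip of `r`, and the
    -- exchange must end at the tip of a second arm. Minimality applies to the exchanged `J₀`
    -- extended by the path of `r`, and the recursion to the exchanged `J`, which has lost both
    -- arms.
    closedArms : ∀ n W J → length W ≤ n → IsJoin (λ v → (T v xor (δ v a xor δ v b)) xor arms W v) J →
                 length J₀ ≤ length J + cost W
    closedArms n [] J _ ∂J = ≤-trans (J₀-min a b J Tb (λ v → ∂J v ∙ xor-identityʳ _)) (m≤m+n _ _)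
    closedArms (suc n) (r ∷ W) J (s≤s len) ∂J with arms W (tip r) in eq
    ... | true =
      let r' , W' , p , same = dropPair tip r W eq
      in ≤-trans (closedArms n W' J (length-tail p len) λ v → ∂J v ∙ cong ((T v xor (δ v a xor δ v b)) xor_) (same v))
                 (+-monoʳ-≤ (length J) (≤-trans (cost-tail p) (m≤n+m (cost W) (slack r))))
    ... | false =
      let y , y≢t , oddy , J₀' , J' , ∂J₀' , ∂J' , len' =
            exchange J₀ J (tip r) (difference (tip r) ∙ cong₂ _xor_ (δ-refl (tip r)) eq)
          r' , W' , y≡ , p = takeAt tip W y
            (sym (cong (_xor arms W y) (δ-≢ y≢t)) ∙ (sym (difference y) ∙ oddy))
          rerouted = J₀-rerouted r y J₀' (cong T y≡ ∙ tip∈T r') ∂J₀'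
          rest = closedArms n W' J' (length-tail p len) λ v →
            ∂J' v ∙ (cong₂ (λ h w → h xor (δ v (tip r) xor δ v w)) (∂J v) y≡ ∙
            (cong (λ w → ((T v xor (δ v a xor δ v b)) xor (δ v (tip r) xor w)) xor (δ v (tip r) xor δ v (tip r')))
                  (atParity-↭ tip p v) ∙
            dropEnds (T v xor (δ v a xor δ v b)) (δ v (tip r)) (δ v (tip r')) (arms W' v)))
      in ≤-trans (+-cancelˡ-≤ (length J₀) _ _ (budget rerouted (short r) rest len'))
                 (≤-trans (suc-slack {length J} {slack r} (slack>0 r'))
                          (+-monoʳ-≤ (length J) (+-monoʳ-≤ (slack r) (≤-reflexive (sym (cost-↭ p))))))
      where
      difference : ∀ v → boundary J₀ v xor boundary J v ≡ arms (r ∷ W) v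
      difference v = cong₂ _xor_ (∂J₀ v) (∂J v) ∙ cancel (T v xor (δ v a xor δ v b)) (arms (r ∷ W) v)

    -- Without the terminal `a` in its boundary, `J` has an odd number of arms, so one of them gets
    -- matched with `a`. Its path then completes the other side to a T-join, of length at least `j`,
    -- and the remaining arms fall to `closedArms`.
    openArms : ∀ n W J → length W ≤ n → IsJoin (λ v → (T v xor δ v b) xor arms W v) J →
               j ≤ suc (length J + cost W)
    openArms n [] J _ ∂J = ⊥-elim (true≢false odd (boundary-even J))
      where
      odd : sum (boundary J) ≡ true
      odd = sum-cong (λ v → ∂J v ∙ xor-identityʳ _) ∙
            (sum-distrib-xor T _ ∙ cong₂ _xor_ T-even (sum-δ-true b))
    openArms (suc n) (r ∷ W) J (s≤s len) ∂J with arms W (tip r) in eq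
    ... | true =
      let r' , W' , p , same = dropPair tip r W eq
      in ≤-trans (openArms n W' J (length-tail p len) λ v → ∂J v ∙ cong ((T v xor δ v b) xor_) (same v))
                 (s≤s (+-monoʳ-≤ (length J) (≤-trans (cost-tail p) (m≤n+m (cost W) (slack r)))))
    ... | false with tip r ≟ a
    ...   | yes t≡a = begin
        j                                  ≤⟨ j-min (J₀ ++ path r) closes ⟩
        length (J₀ ++ path r)              ≡⟨ length-++ J₀ ⟩
        length J₀ + length (path r)        ≤⟨ +-mono-≤ atA (short r) ⟩
        (length J + cost W) + suc (slack r) ≡⟨ arith (length J) (cost W) (slack r) ⟩
        suc (length J + (slack r + cost W)) ∎
      where
      open ≤-Reasoning
      open +-*-Solver using () renaming (solve to solveℕ; _:+_ to _⊕_; _:=_ to _⊜_; con to conℕ)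
      arith : ∀ m c s → (m + c) + suc s ≡ suc (m + (s + c))
      arith = solveℕ 3 (λ m c s → (m ⊕ c) ⊕ (conℕ 1 ⊕ s) ⊜ conℕ 1 ⊕ (m ⊕ (s ⊕ c))) refl
      lemma₁ : ∀ T a b → (T xor (a xor b)) xor (b xor a) ≡ T
      lemma₁ = solve 3 (λ T a b → (T :+ (a :+ b)) :+ (b :+ a) := T) refl
      lemma₂ : ∀ T a b w → (T xor b) xor (a xor w) ≡ (T xor (a xor b)) xor w
      lemma₂ = solve 4 (λ T a b w → (T :+ b) :+ (a :+ w) := (T :+ (a :+ b)) :+ w) refl
      closes : IsJoin T (J₀ ++ path r)
      closes v = boundary-++ J₀ (path r) v ∙ (cong₂ _xor_ (∂J₀ v) (∂path r v ∙ cong (λ t → δ v b xor δ v t) t≡a) ∙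
                 lemma₁ (T v) (δ v a) (δ v b))
      atA : length J₀ ≤ length J + cost W
      atA = closedArms n W J len λ v → ∂J v ∙ (cong (λ t → (T v xor δ v b) xor (δ v t xor arms W v)) t≡a ∙
            lemma₂ (T v) (δ v a) (δ v b) (arms W v))
    ...   | no t≢a = exchangeOpen (exchange J₀ J (tip r) (difference (tip r) ∙
                       cong₂ _xor_ (δ-≢ t≢a) (cong₂ _xor_ (δ-refl (tip r)) eq)))
      where
      lemma : ∀ T a b w → (T xor (a xor b)) xor ((T xor b) xor w) ≡ a xor w
      lemma = solve 4 (λ T a b w → (T :+ (a :+ b)) :+ ((T :+ b) :+ w) := a :+ w) refl
      difference : ∀ v → boundary J₀ v xor boundary J v ≡ δ v a xor arms (r ∷ W) v
      difference v = cong₂ _xor_ (∂J₀ v) (∂J v) ∙ lemma (T v) (δ v a) (δ v b) (arms (r ∷ W) v)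

      exchangeOpen : Exchanged J₀ J (tip r) → j ≤ suc (length J + cost (r ∷ W))
      exchangeOpen (y , y≢t , oddy , J₀' , J' , ∂J₀' , ∂J' , len') with y ≟ a
      ... | yes y≡a = +-cancelˡ-≤ (length J₀) _ _ (≤-trans (≤-reflexive (+-comm (length J₀) j))
                        (budget closes (short r) atA len'))
        where
        lemma₁ : ∀ T a b t → ((T xor (a xor b)) xor (t xor a)) xor (b xor t) ≡ T
        lemma₁ = solve 4 (λ T a b t → ((T :+ (a :+ b)) :+ (t :+ a)) :+ (b :+ t) := T) refl
        lemma₂ : ∀ T a b t w → ((T xor b) xor (t xor w)) xor (t xor a) ≡ (T xor (a xor b)) xor w
        lemma₂ = solve 5 (λ T a b t w → ((T :+ b) :+ (t :+ w)) :+ (t :+ a) := (T :+ (a :+ b)) :+ w) refl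
        closes : j ≤ length J₀' + length (path r)
        closes = ≤-trans (j-min (J₀' ++ path r) λ v → boundary-++ J₀' (path r) v ∙
            (cong₂ _xor_ (∂J₀' v ∙ cong₂ (λ h t → h xor (δ v (tip r) xor δ v t)) (∂J₀ v) y≡a) (∂path r v) ∙
            lemma₁ (T v) (δ v a) (δ v b) (δ v (tip r)))) (≤-reflexive (length-++ J₀'))
        atA : length J₀ ≤ length J' + cost W
        atA = closedArms n W J' len λ v → ∂J' v ∙ (cong₂ (λ h t → h xor (δ v (tip r) xor δ v t)) (∂J v) y≡a ∙
              lemma₂ (T v) (δ v a) (δ v b) (δ v (tip r)) (arms W v))
      ... | no y≢a =
        let r' , W' , y≡ , p = takeAt tip W y
              (sym (cong₂ _xor_ (δ-≢ y≢a) (cong (_xor arms W y) (δ-≢ y≢t))) ∙ (sym (difference y) ∙ oddy))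
            rerouted = J₀-rerouted r y J₀' (cong T y≡ ∙ tip∈T r') ∂J₀'
            rest = openArms n W' J' (length-tail p len) λ v →
              ∂J' v ∙ (cong₂ (λ h w → h xor (δ v (tip r) xor δ v w)) (∂J v) y≡ ∙
              (cong (λ w → ((T v xor δ v b) xor (δ v (tip r) xor w)) xor (δ v (tip r) xor δ v (tip r')))
                    (atParity-↭ tip p v) ∙
              dropEnds (T v xor δ v b) (δ v (tip r)) (δ v (tip r')) (arms W' v)))
        in ≤-trans (+-cancelˡ-≤ (length J₀) _ _ (budget rerouted (short r)
               (≤-trans rest (≤-reflexive (sym (+-suc (length J') (cost W'))))) len'))
             (s≤s (+-monoʳ-≤ (length J) (+-monoʳ-≤ (slack r)
               (≤-trans (+-monoˡ-≤ (cost W') (slack>0 r')) (≤-reflexive (sym (cost-↭ p)))))))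

    arms∉T : ∀ W v → T v ≡ false → arms W v ≡ false
    arms∉T W v v∉T = ¬-not λ odd → let r , _ , v≡ , _ = takeAt tip W v odd in
                     true≢false (cong T v≡ ∙ tip∈T r) v∉T

    -- A trail of `J` from a foot ends at another foot, at the tip of an arm, or at a new element of
    -- T. In the first two cases both ends disappear and the trail is discarded. In the third the
    -- trail becomes an arm with its own length as slack, so `length J + cost W` stays the same.
    spokesAndArms : ∀ n U W J → length U ≤ n →
      IsJoin (λ v → (T v xor δ v b) xor (spokes U v xor arms W v)) J → j ≤ suc (length J + cost W)
    spokesAndArms n [] W J _ ∂J = openArms (length W) W J ≤-refl ∂J
    spokesAndArms (suc n) (s ∷ U) W J (s≤s len) ∂J with spokes U (foot s) in eq
    ... | true =
      let s' , U' , p , same = dropPair foot s U eq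
      in spokesAndArms n U' W J (length-tail p len) λ v → ∂J v ∙ cong (λ u → (T v xor δ v b) xor (u xor arms W v)) (same v)
    ... | false = split (extractTrail J (foot s) (∂J (foot s) ∙ cong₂ _xor_
                    (cong₂ _xor_ (foot∉T s) (δ-≢ foot≢b))
                    (cong₂ _xor_ (cong₂ _xor_ (δ-refl (foot s)) eq) (arms∉T W (foot s) (foot∉T s)))))
      where
      foot≢b : foot s ≢ b
      foot≢b f≡b = true≢false (cong T f≡b ∙ Tb) (foot∉T s)

      split : OddTrail J (foot s) → j ≤ suc (length J + cost W)
      split (y , y≢f , oddy , X , R , w , q) = classify
        where
        sizes : length J ≡ length X + length R
        sizes = ↭-length q ∙ length-++ X
        R≤J : length R ≤ length J
        R≤J = ≤-trans (m≤n+m _ (length X)) (≤-reflexive (sym sizes))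
        lemma : ∀ j x r → j ≡ x xor r → r ≡ j xor x
        lemma j x r refl = solve 2 (λ x r → r := (x :+ r) :+ x) refl x r
        ∂R : ∀ v → boundary R v ≡
             ((T v xor δ v b) xor ((δ v (foot s) xor spokes U v) xor arms W v)) xor (δ v (foot s) xor δ v y)
        ∂R v = lemma _ (boundary X v) _ (boundary-↭ q v ∙ boundary-++ X R v) ∙ cong₂ _xor_ (∂J v) (boundary-Trail w v)
        classify : j ≤ suc (length J + cost W)
        classify with spokes U y in eqU | arms W y in eqW | T y in eqT
        ... | true | _ | _ =
          let s' , U' , y≡ , p = takeAt foot U y eqU
          in ≤-trans (spokesAndArms n U' W R (length-tail p len) λ v → ∂R v ∙
               (cong₂ (λ u y → ((T v xor δ v b) xor ((δ v (foot s) xor u) xor arms W v)) xor (δ v (foot s) xor δ v y))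
                    (atParity-↭ foot p v) y≡ ∙
                lemma₁ (T v xor δ v b) (δ v (foot s)) (δ v (foot s')) (spokes U' v) (arms W v)))
             (s≤s (+-monoˡ-≤ (cost W) R≤J))
          where
          lemma₁ : ∀ s f y u w → (s xor ((f xor (y xor u)) xor w)) xor (f xor y) ≡ s xor (u xor w)
          lemma₁ = solve 5 (λ s f y u w → (s :+ ((f :+ (y :+ u)) :+ w)) :+ (f :+ y) := s :+ (u :+ w)) refl
        ... | false | true | _ =
          let r' , W' , y≡ , p = takeAt tip W y eqW
          in ≤-trans (spokesAndArms n U W' R len λ v → ∂R v ∙
               (cong₂ (λ w y → ((T v xor δ v b) xor ((δ v (foot s) xor spokes U v) xor w)) xor (δ v (foot s) xor δ v y))
                    (atParity-↭ tip p v) y≡ ∙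
                lemma₂ (T v xor δ v b) (δ v (foot s)) (δ v (tip r')) (spokes U v) (arms W' v)))
             (s≤s (+-mono-≤ R≤J (cost-tail p)))
          where
          lemma₂ : ∀ s f y u w → (s xor ((f xor u) xor (y xor w))) xor (f xor y) ≡ s xor (u xor w)
          lemma₂ = solve 5 (λ s f y u w → (s :+ ((f :+ u) :+ (y :+ w))) :+ (f :+ y) := s :+ (u :+ w)) refl
        ... | false | false | true =
          ≤-trans (spokesAndArms n U (newArm ∷ W) R len λ v → ∂R v ∙
                     lemma₃ (T v xor δ v b) (δ v (foot s)) (δ v y) (spokes U v) (arms W v))
                  (s≤s (≤-reflexive (sym (cong (_+ cost W) sizes ∙ arith (length X) (length R) (cost W)))))
          where
          arith : ∀ x r w → (x + r) + w ≡ r + (x + w)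
          arith = solveℕ 3 (λ x r w → (x ⊕ r) ⊕ w ⊜ r ⊕ (x ⊕ w)) refl
            where open +-*-Solver using () renaming (solve to solveℕ; _:+_ to _⊕_; _:=_ to _⊜_)
          lemma₃ : ∀ s f y u w → (s xor ((f xor u) xor w)) xor (f xor y) ≡ s xor (u xor (y xor w))
          lemma₃ = solve 5 (λ s f y u w → (s :+ ((f :+ u) :+ w)) :+ (f :+ y) := s :+ (u :+ (y :+ w))) refl
          lemma₄ : ∀ b f y → (b xor f) xor (f xor y) ≡ b xor y
          lemma₄ = solve 3 (λ b f y → (b :+ f) :+ (f :+ y) := b :+ y) refl
          nonempty : ∀ {X} → Trail (foot s) X y → 1 ≤ length X
          nonempty {_ ∷ _} _ = s≤s z≤n
          nonempty {[]} [] = ⊥-elim (y≢f refl)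
          newArm : Arm
          newArm = arm y eqT (length X) (nonempty w) (rim s ∷ X)
            (λ v → cong₂ _xor_ (∂rim s v) (boundary-Trail w v) ∙ lemma₄ (δ v b) (δ v (foot s)) (δ v y)) ≤-refl
        -- The only other candidate for an odd vertex is `b`, and `b` lies in T.
        ... | false | false | false =
          ⊥-elim (true≢false (cong T y≡b ∙ Tb) eqT)
          where
          lemma₅ : ∀ c → (false xor c) xor ((false xor false) xor false) ≡ c
          lemma₅ false = refl
          lemma₅ true = refl
          y≡b : y ≡ b
          y≡b = δ-true (sym (lemma₅ (δ y b)) ∙ (sym (∂J y ∙ cong₂ _xor_ (cong (_xor δ y b) eqT)
                  (cong₂ _xor_ (cong₂ _xor_ (δ-≢ y≢f) eqU) eqW)) ∙ oddy))

    -- By parity the spokes are odd in number, so adding all their rim links would turn `J` into a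
    -- T-join; the point is that the loss is 1 and not the number of spokes.
    shrink : ∀ U J → IsJoin (λ v → (T v xor δ v b) xor spokes U v) J → j ≤ suc (length J)
    shrink U J ∂J = ≤-trans (spokesAndArms (length U) U [] J ≤-refl λ v →
                               ∂J v ∙ cong ((T v xor δ v b) xor_) (sym (xor-identityʳ _)))
                            (s≤s (≤-reflexive (+-identityʳ _)))

-- Packings of odd cuts, contraction of faces, and the induction.

∧-true : ∀ {a b} → a ∧ b ≡ true → a ≡ true × b ≡ true
∧-true {true} {true} _ = refl , refl

countF-mono : ∀ {k} {p q : Fin k → Bool} → (∀ i → p i ≡ true → q i ≡ true) → countF p ≤ countF q
countF-mono {zero} h = z≤n
countF-mono {suc k} {p} {q} h with p zero in p₀ | q zero in q₀
... | false | false = countF-mono (h ∘ suc)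
... | false | true = m≤n⇒m≤1+n (countF-mono (h ∘ suc))
... | true | true = s≤s (countF-mono (h ∘ suc))
... | true | false = ⊥-elim (true≢false (h zero p₀) q₀)

countF-mono-< : ∀ {k} {p q : Fin k → Bool} → (∀ i → p i ≡ true → q i ≡ true) →
                ∀ i → p i ≡ false → q i ≡ true → countF p < countF q
countF-mono-< {suc k} {p} {q} h zero pi qi rewrite pi | qi = s≤s (countF-mono (h ∘ suc))
countF-mono-< {suc k} {p} {q} h (suc i) pi qi with p zero in p₀ | q zero in q₀
... | false | false = countF-mono-< (h ∘ suc) i pi qi
... | false | true = m≤n⇒m≤1+n (countF-mono-< (h ∘ suc) i pi qi)
... | true | true = s≤s (countF-mono-< (h ∘ suc) i pi qi)
... | true | false = ⊥-elim (true≢false (h zero p₀) q₀)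

countF-pos : ∀ {k} {p : Fin k → Bool} i → p i ≡ true → 1 ≤ countF p
countF-pos {p = p} i pi = ≤-trans (s≤s z≤n) (countF-mono-< {p = λ _ → false} {p} (λ _ ()) i refl pi)

-- If no value were least, every value could be lowered, and descent in ℕ refutes that. No search
-- through X takes place, so the minimum is available only for proving stable goals.
¬¬-minimal : {X : Set} (f : X → ℕ) → X → ¬ ¬ (∃ λ x → ∀ y → f x ≤ f y)
¬¬-minimal {X} f x none = below (suc (f x)) x ≤-refl
  where
  below : ∀ n x → ¬ f x < n
  below (suc n) x (s≤s fx≤n) = none (x , λ y → ≮⇒≥ λ fy<fx → below n y (≤-trans fy<fx fx≤n))

module Cuts {K N : ℕ} (A : Fin K → Fin N → Set) where

  -- The vertices that an odd cycle around `Z` may use; disjointness and avoidance of cycles are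
  -- therefore imposed on these sets.
  Crosses : (Fin K → Bool) → Fin N → Set
  Crosses Z v = ∃ λ f → ∃ λ g → A f v × A g v × Z f ≢ Z g

  record Packing (T D : Fin K → Bool) (s : ℕ) : Set where
    field
      cut      : Fin s → Fin K → Bool
      cut-odd  : ∀ i → cut i · T ≡ true
      disjoint : ∀ i j → i ≢ j → ∀ v → Crosses (cut i) v → ¬ Crosses (cut j) v
      avoid    : ∀ i f v → D f ≡ true → A f v → ¬ Crosses (cut i) v

  empty : ∀ {T D} → Packing T D 0
  empty = record { cut = λ () ; cut-odd = λ () ; disjoint = λ () ; avoid = λ () }

module Contraction {K N : ℕ} (A : Fin K → Fin N → Set) (c : Fin K → Fin K) where

  -- The index set stays `Fin K`: a face outside the image of `c` just has no vertices left. Hence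
  -- the number of faces cannot serve as the induction measure.
  A' : Fin K → Fin N → Set
  A' k v = ∃ λ f → c f ≡ k × A f v

  open Incidence A
  open Cuts A
  private
    module I' = Incidence A'
    module C' = Cuts A'

  fibreSum : (Fin K → Bool) → Fin K → Bool
  fibreSum = lin (λ f k → δ k (c f))

  ·-fibreSum : ∀ Z S → Z · fibreSum S ≡ (Z ∘ c) · S
  ·-fibreSum Z S = ·-lin _ S Z ∙ (·-cong (λ _ → refl) (λ f → ·-δ Z (c f)) ∙ ·-comm S _)

  contract? : (∀ f v → Dec (A f v)) → ∀ k v → Dec (A' k v)
  contract? A? k v = any? λ f → (c f ≟ k) ×-dec A? f v

  lift : I'.Link → Link
  lift (I'.link k l k≢l v (f , cf , Af) (g , cg , Ag)) =
    link f g (λ f≡g → k≢l (sym cf ∙ (cong c f≡g ∙ cg))) v Af Ag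

  push : Link → Maybe I'.Link
  push (link f g f≢g v Af Ag) with c f ≟ c g
  ... | yes _ = nothing
  ... | no cf≢cg = just (I'.link (c f) (c g) cf≢cg v (f , refl , Af) (g , refl , Ag))

  fibreSum-boundary : ∀ J k → fibreSum (boundary J) k ≡ xorSum (λ e → δ k (c (left e)) xor δ k (c (right e))) J
  fibreSum-boundary J k = ·-comm (boundary J) _ ∙ ·-boundary (λ f → δ k (c f)) J

  boundary-lift : ∀ J k → fibreSum (boundary (map lift J)) k ≡ I'.boundary J k
  boundary-lift J k = fibreSum-boundary (map lift J) k ∙ go J
    where
    go : ∀ J → xorSum (λ e → δ k (c (left e)) xor δ k (c (right e))) (map lift J) ≡ I'.boundary J k
    go [] = refl
    go (I'.link _ _ _ _ (f , refl , _) (g , refl , _) ∷ J) = cong ((δ k (c f) xor δ k (c g)) xor_) (go J)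

  boundary-push : ∀ J k → I'.boundary (mapMaybe push J) k ≡ fibreSum (boundary J) k
  boundary-push J k = go J ∙ sym (fibreSum-boundary J k)
    where
    go : ∀ J → I'.boundary (mapMaybe push J) k ≡ xorSum (λ e → δ k (c (left e)) xor δ k (c (right e))) J
    go [] = refl
    go (link f g f≢g v Af Ag ∷ J) with c f ≟ c g
    ... | yes cf≡cg = go J ∙ cong (_xor S) (sym (cong (δ k (c f) xor_) (cong (δ k) (sym cf≡cg)) ∙ xor-same (δ k (c f))))
      where S = xorSum (λ e → δ k (c (left e)) xor δ k (c (right e))) J
    ... | no _ = cong ((δ k (c f) xor δ k (c g)) xor_) (go J)

  -- Odd degree at `b` forces a link there; the contraction makes it a loop, which `push` drops.
  push-shorter : ∀ {J b} → boundary J b ≡ true → (∀ e → ends b e ≡ true → c (left e) ≡ c (right e)) →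
                 length (mapMaybe push J) < length J
  push-shorter {J} {b} odd loop with xorSum-true (ends b) J odd
  ... | e@(link f g _ _ _ _) , J' , here , p =
    ≤-trans (s≤s (≤-trans (≤-reflexive (↭-length (mapMaybe-↭ push p))) shorter)) (≤-reflexive (sym (↭-length p)))
    where
    shorter : length (mapMaybe push (e ∷ J')) ≤ length J'
    shorter with c f ≟ c g
    ... | yes _ = length-mapMaybe push J'
    ... | no cf≢cg = ⊥-elim (cf≢cg (loop e here))

  Crosses-∘ : ∀ {Z v} → Crosses (Z ∘ c) v → C'.Crosses Z v
  Crosses-∘ (f , g , Af , Ag , Zf≢Zg) = c f , c g , (f , refl , Af) , (g , refl , Ag) , Zf≢Zg

  module _ {T D D' : Fin K → Bool} (D⊆D' : ∀ f → D f ≡ true → D' (c f) ≡ true) where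

    fibreSum-⊆ : (∀ f → T f ≡ true → D f ≡ true) → ∀ k → fibreSum T k ≡ true → D' k ≡ true
    fibreSum-⊆ T⊆D k odd =
      let f , here = sum-true _ odd
          Tf , k≡cf = ∧-true {T f} here
      in cong D' (δ-true {i = k} {c f} k≡cf) ∙ D⊆D' f (T⊆D f Tf)

    pullback : ∀ {s} → C'.Packing (fibreSum T) D' s → Packing T D s
    pullback P = record
      { cut      = λ i → cut i ∘ c
      ; cut-odd  = λ i → sym (·-fibreSum (cut i) T) ∙ cut-odd i
      ; disjoint = λ i j i≢j v p q → disjoint i j i≢j v (Crosses-∘ p) (Crosses-∘ q)
      ; avoid    = λ i f v Df Af p → avoid i (c f) v (D⊆D' f Df) (f , refl , Af) (Crosses-∘ p)
      } where open C'.Packing P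

collect : ∀ {m} {E : Set} (P : Fin m → Bool) → (∀ i → P i ≡ true → E) → List E
collect {zero} P g = []
collect {suc m} P g with P zero ≟ᵇ true
... | yes p = g zero p ∷ collect (P ∘ suc) (g ∘ suc)
... | no _ = collect (P ∘ suc) (g ∘ suc)

xorSum-collect : ∀ {m} {E : Set} (P : Fin m → Bool) (g : ∀ i → P i ≡ true → E)
                 (f : E → Bool) (h : Fin m → Bool) → (∀ i p → f (g i p) ≡ h i) →
                 xorSum f (collect P g) ≡ P · h
xorSum-collect {zero} P g f h e = sym (sum-zero λ ())
xorSum-collect {suc m} P g f h e with P zero ≟ᵇ true | xorSum-collect (P ∘ suc) (g ∘ suc) f (h ∘ suc) (e ∘ suc)
... | yes p | rest = cong₂ _xor_ (e zero p) rest ∙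
                     sym (sum-suc _ ∙ cong (λ b → (b ∧ h zero) xor (P ∘ suc) · (h ∘ suc)) p)
... | no p | rest = rest ∙ sym (sum-suc _ ∙ cong (λ b → (b ∧ h zero) xor (P ∘ suc) · (h ∘ suc)) (¬-not p))

module Induction (K N : ℕ) where

  Bound : (A : Fin K → Fin N → Set) (T D : Fin K → Bool) → Set
  Bound A T D = ∀ t ν → (∀ J → IsJoin T J → t ≤ length J) → (∀ s → Packing T D s → s ≤ ν) → t + 2 ≤ ν + 2 * countF D
    where
    open Incidence A
    open Cuts A

  module _ (A : Fin K → Fin N → Set) (T D : Fin K → Bool) (T⊆D : ∀ f → T f ≡ true → D f ≡ true) where

    open Incidence A
    open Cuts A

    Share : Fin K → Fin K → Set
    Share f g = ∃ λ v → A f v × A g v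

    Close : Fin K → Fin K → Set
    Close f g = D f ≡ true × D g ≡ true × f ≢ g × ∃ λ h → Share f h × Share h g

    connect : ∀ f g → Share f g → ∃ λ J → IsJoin (λ v → δ v f xor δ v g) J × length J ≤ 1
    connect f g (v , Af , Ag) with f ≟ g
    ... | yes refl = [] , (λ v → sym (xor-same (δ v f))) , z≤n
    ... | no f≢g = link f g f≢g v Af Ag ∷ [] , (λ v → xor-identityʳ _) , ≤-refl

    module Merge {f g : Fin K} (close : Close f g) where

      private
        Df = proj₁ close
        Dg = proj₁ (proj₂ close)
        f≢g = proj₁ (proj₂ (proj₂ close))

      c : Fin K → Fin K
      c x with x ≟ g
      ... | yes _ = f
      ... | no _ = x

      D' : Fin K → Bool
      D' x = D x ∧ not (δ x g)

      D⊆D' : ∀ x → D x ≡ true → D' (c x) ≡ true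
      D⊆D' x Dx with x ≟ g
      ... | yes _ = cong₂ (λ a b → a ∧ not b) Df (δ-≢ f≢g)
      ... | no x≢g = cong₂ (λ a b → a ∧ not b) Dx (δ-≢ x≢g)

      fewer : countF D' < countF D
      fewer = countF-mono-< (λ i → proj₁ ∘ ∧-true {D i}) g (cong₂ (λ a b → a ∧ not b) Dg (δ-refl g)) Dg

      open Contraction A c public

      fibre-other : ∀ U k → k ≢ f → k ≢ g → fibreSum U k ≡ U k
      fibre-other U k k≢f k≢g = sum-cong (λ x → cong (U x ∧_) (at x) ∙ ∧-comm (U x) _) ∙ sum-δ k U
        where
        at : ∀ x → δ k (c x) ≡ δ k x
        at x with x ≟ g
        ... | yes refl = δ-≢ k≢f ∙ sym (δ-≢ k≢g)
        ... | no _ = refl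

      fibre-f : ∀ U → fibreSum U f ≡ U f xor U g
      fibre-f U = sum-cong (λ x → cong (U x ∧_) (at x)) ∙ (·-distribˡ U (λ x → δ x f) (λ x → δ x g) ∙ cong₂ _xor_ (·-δ U f) (·-δ U g))
        where
        at : ∀ x → δ f (c x) ≡ δ x f xor δ x g
        at x with x ≟ g
        ... | yes refl = δ-refl f ∙ cong (_xor true) (sym (δ-≢ (f≢g ∘ sym)))
        ... | no x≢g = δ-sym f x ∙ sym (xor-identityʳ _)

      -- The defect of the lifted join is even on each fibre, so it vanishes off `f` and `g` and
      -- takes the same value on both. If that value is odd, the two links through the middle face
      -- `h` repair it.
      join-lift : ∀ J' → Incidence.IsJoin A' (fibreSum T) J' → ∃ λ J → IsJoin T J × length J ≤ length J' + 2
      join-lift J' ∂J' = fix (U f) refl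
        where
        L = map lift J'
        U : Fin K → Bool
        U v = boundary L v xor T v
        U-even : ∀ k → fibreSum U k ≡ false
        U-even k = ·-distribʳ (λ x → δ k (c x)) (boundary L) T ∙
                   (cong (_xor fibreSum T k) (boundary-lift J' k ∙ ∂J' k) ∙ xor-same (fibreSum T k))
        Uf≡Ug : U f ≡ U g
        Uf≡Ug = xor-cancel (sym (fibre-f U) ∙ U-even f)
        fix : ∀ u → U f ≡ u → ∃ λ J → IsJoin T J × length J ≤ length J' + 2
        fix false Uf = L , (λ v → xor-cancel (zeroU v)) , ≤-trans (≤-reflexive (length-map lift J')) (m≤m+n _ 2)
          where
          zeroU : ∀ v → U v ≡ false
          zeroU v with v ≟ f | v ≟ g
          ... | yes refl | _ = Uf
          ... | no _ | yes refl = sym Uf≡Ug ∙ Uf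
          ... | no v≢f | no v≢g = sym (fibre-other U v v≢f v≢g) ∙ U-even v
        fix true Uf with proj₂ (proj₂ (proj₂ close))
        ... | h , fh , hg =
          let P , ∂P , |P|≤1 = connect f h fh
              Q , ∂Q , |Q|≤1 = connect h g hg
          in L ++ P ++ Q ,
             (λ v → boundary-++ L (P ++ Q) v ∙ (cong (boundary L v xor_) (boundary-++ P Q v ∙
                    (cong₂ _xor_ (∂P v) (∂Q v) ∙ telescope (δ v f) (δ v h) (δ v g))) ∙ (cong (boundary L v xor_) (sym (U-fg v)) ∙
                    cancel (boundary L v) (T v)))) ,
             ≤-trans (≤-reflexive (length-++ L ∙ cong (length L +_) (length-++ P)))
                     (+-mono-≤ (≤-reflexive (length-map lift J')) (+-mono-≤ |P|≤1 |Q|≤1))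
          where
          open xor-∧-Solver
          telescope : ∀ f h g → (f xor h) xor (h xor g) ≡ f xor g
          telescope = solve 3 (λ f h g → (f :+ h) :+ (h :+ g) := f :+ g) refl
          U-fg : ∀ v → U v ≡ δ v f xor δ v g
          U-fg v with v ≟ f | v ≟ g
          ... | yes refl | yes f≡g = ⊥-elim (f≢g f≡g)
          ... | yes refl | no _ = Uf
          ... | no _ | yes refl = sym Uf≡Ug ∙ Uf
          ... | no v≢f | no v≢g = sym (fibre-other U v v≢f v≢g) ∙ U-even v

      merge : Bound A' (fibreSum T) D' → Bound A T D
      merge bound t ν joins packings = begin
        t + 2                               ≤⟨ +-monoˡ-≤ 2 (m≤n+m∸n t 2) ⟩
        (2 + (t ∸ 2)) + 2                   ≡⟨ +-assoc 2 (t ∸ 2) 2 ⟩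
        2 + ((t ∸ 2) + 2)                   ≤⟨ +-monoʳ-≤ 2 (bound (t ∸ 2) ν joins' (λ s P → packings s (pullback D⊆D' P))) ⟩
        2 + (ν + 2 * countF D')             ≡⟨ arith ν (countF D') ⟩
        ν + 2 * suc (countF D')             ≤⟨ +-monoʳ-≤ ν (*-monoʳ-≤ 2 fewer) ⟩
        ν + 2 * countF D                    ∎
        where
        open ≤-Reasoning
        arith : ∀ ν d → 2 + (ν + 2 * d) ≡ ν + 2 * suc d
        arith = solve 2 (λ ν d → con 2 :+ (ν :+ con 2 :* d) := ν :+ con 2 :* (con 1 :+ d)) refl
          where open +-*-Solver
        joins' : ∀ J' → Incidence.IsJoin A' (fibreSum T) J' → t ∸ 2 ≤ length J'
        joins' J' ∂J' = let J , ∂J , len = join-lift J' ∂J' in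
          ≤-trans (∸-monoˡ-≤ 2 (≤-trans (joins J ∂J) len)) (≤-reflexive (m+n∸n≡m _ 2))

    module Grow (A? : ∀ f v → Dec (A f v)) (apart : ∀ f g → ¬ Close f g) (b : Fin K) (Tb : T b ≡ true) where

      Near : Fin K → Set
      Near x = x ≡ b ⊎ Share b x

      near? : ∀ x → Dec (Near x)
      near? x = (x ≟ b) ⊎-dec any? (λ v → A? b v ×-dec A? x v)

      c : Fin K → Fin K
      c x with near? x
      ... | yes _ = b
      ... | no _ = x

      c-near : ∀ {x} → Near x → c x ≡ b
      c-near {x} near with near? x
      ... | yes _ = refl
      ... | no far = ⊥-elim (far near)

      c-far : ∀ {x} → ¬ Near x → c x ≡ x
      c-far {x} far with near? x
      ... | yes near = ⊥-elim (far near)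
      ... | no _ = refl

      -- `b` is deadly and may itself be the middle face in `Close`, so no other deadly face shares
      -- a vertex with it. Consequently the contraction fixes every deadly face.
      D-far : ∀ x → D x ≡ true → x ≢ b → ¬ Near x
      D-far x Dx x≢b (inj₁ x≡b) = x≢b x≡b
      D-far x Dx x≢b (inj₂ (v , Ab , Ax)) =
        apart b x (T⊆D b Tb , Dx , x≢b ∘ sym , b , (v , Ab , Ab) , (v , Ab , Ax))

      c-D : ∀ x → D x ≡ true → c x ≡ x
      c-D x Dx = [_,_] {C = λ _ → c x ≡ x} (λ x≡b → c-near (inj₁ x≡b) ∙ sym x≡b) (λ x≢b → c-far (D-far x Dx x≢b))
                       (toSum (x ≟ b))

      D⊆D' : ∀ x → D x ≡ true → D (c x) ≡ true
      D⊆D' x Dx = cong D (c-D x Dx) ∙ Dx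

      open Contraction A c public

      fibre-far : ∀ U k → ¬ Near k → fibreSum U k ≡ U k
      fibre-far U k far = sum-cong (λ x → cong (U x ∧_) (at x) ∙ ∧-comm (U x) _) ∙ sum-δ k U
        where
        at : ∀ x → δ k (c x) ≡ δ k x
        at x with near? x
        ... | yes near = δ-≢ (λ { refl → far (inj₁ refl) }) ∙ sym (δ-≢ λ { refl → far near })
        ... | no _ = refl

      T'b : fibreSum T b ≡ true
      T'b = sum-cong at ∙ (sum-δ b T ∙ Tb)
        where
        at : ∀ x → T x ∧ δ b (c x) ≡ δ b x ∧ T x
        at x with T x in Tx
        ... | true = cong (δ b) (c-D x (T⊆D x Tx)) ∙ sym (∧-identityʳ _)
        ... | false = sym (∧-zeroʳ (δ b x))

      loop-at-b : ∀ e → ends b e ≡ true → c (left e) ≡ c (right e)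
      loop-at-b e here with xor-true {δ b (left e)} here
      ... | inj₁ p with refl ← δ-true {i = b} {left e} p =
            c-near (inj₁ refl) ∙ sym (c-near (inj₂ (via e , on-left e , on-right e)))
      ... | inj₂ p with refl ← δ-true {i = b} {right e} p =
            c-near (inj₂ (via e , on-right e , on-left e)) ∙ sym (c-near (inj₁ refl))

      push-shrinks : ∀ J → IsJoin T J → length (mapMaybe push J) < length J
      push-shrinks J ∂J = push-shorter {J} {b} (∂J b ∙ Tb) loop-at-b

      grow-packing : ∀ {s} → Cuts.Packing A' (fibreSum T) D s → Packing T D (suc s)
      grow-packing {s} P = record { cut = cut' ; cut-odd = odd' ; disjoint = disjoint' ; avoid = avoid' }
        where
        open Packing (pullback D⊆D' P)
        ball : Fin K → Bool
        ball x = δ b (c x)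

        cut' : Fin (suc s) → Fin K → Bool
        cut' = cons ball cut

        odd' : ∀ i → cut' i · T ≡ true
        odd' zero = ·-comm ball T ∙ T'b
        odd' (suc i) = cut-odd i

        -- A vertex on the rim of the ball lies on a face of the ball, whose image b is deadly.
        rim : ∀ {v} → Crosses ball v → ∃ λ f → ∃ λ g → Near f × ¬ Near g × A f v × A g v
        rim (f , g , Af , Ag , differ) with near? f | near? g
        ... | yes near | no far = f , g , near , far , Af , Ag
        ... | no far | yes near = g , f , near , far , Ag , Af
        ... | yes _ | yes _ = ⊥-elim (differ refl)
        ... | no f≁ | no g≁ = ⊥-elim (differ (δ-≢ (λ { refl → f≁ (inj₁ refl) }) ∙ sym (δ-≢ λ { refl → g≁ (inj₁ refl) })))

        ball-disjoint : ∀ i v → Crosses ball v → ¬ Crosses (cut i) v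
        ball-disjoint i v p q =
          let f , g , near , far , Af , Ag = rim p
          in Cuts.Packing.avoid P i b v (T⊆D b Tb) (f , c-near near , Af) (Crosses-∘ q)

        disjoint' : ∀ i j → i ≢ j → ∀ v → Crosses (cut' i) v → ¬ Crosses (cut' j) v
        disjoint' zero zero i≢j = ⊥-elim (i≢j refl)
        disjoint' zero (suc j) _ v p q = ball-disjoint j v p q
        disjoint' (suc i) zero _ v p q = ball-disjoint i v q p
        disjoint' (suc i) (suc j) i≢j = disjoint i j (i≢j ∘ cong suc)

        -- A rim vertex lies on a near and on a far face. If `b` passed through it, the far face
        -- would be near; any other deadly face through it would be at most two links from `b`, by
        -- way of the near face.
        avoid' : ∀ i f v → D f ≡ true → A f v → ¬ Crosses (cut' i) v
        avoid' (suc i) = avoid i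
        avoid' zero h v Dh Ah p with rim p
        ... | f , g , near , far , Af , Ag with h ≟ b
        ...   | yes refl = far (inj₂ (v , Ah , Ag))
        ...   | no h≢b with near
        ...     | inj₁ refl = D-far h Dh h≢b (inj₂ (v , Af , Ah))
        ...     | inj₂ bf = apart b h (T⊆D b Tb , Dh , h≢b ∘ sym , f , bf , (v , Af , Ah))

      module _ (a : Fin K) (J₀ : List Link) (∂J₀ : IsJoin (λ v → T v xor (δ v a xor δ v b)) J₀)
        (J₀-min : ∀ a' b' J → T b' ≡ true → IsJoin (λ v → T v xor (δ v a' xor δ v b')) J → length J₀ ≤ length J)
        (j : ℕ) (j-min : ∀ J → IsJoin T J → j ≤ length J) (T-even : sum T ≡ false) where

        open Shrinking T a b Tb J₀ ∂J₀ J₀-min j j-min T-even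

        -- A link at `b` stays inside the ball, so no lifted link touches `b`, and the defect there
        -- is odd. All other defects lie in the ball and outside T, since `b` is the only deadly
        -- face in the ball; they are the feet.
        join-lift : ∀ J' → Incidence.IsJoin A' (fibreSum T) J' → j ≤ suc (length J')
        join-lift J' ∂J' = ≤-trans (shrink feet L ∂L) (s≤s (≤-reflexive (length-map lift J')))
          where
          L = map lift J'
          U : Fin K → Bool
          U v = boundary L v xor T v
          U-even : ∀ k → fibreSum U k ≡ false
          U-even k = ·-distribʳ (λ x → δ k (c x)) (boundary L) T ∙
                     (cong (_xor fibreSum T k) (boundary-lift J' k ∙ ∂J' k) ∙ xor-same (fibreSum T k))

          lift-proper : ∀ e' → c (left (lift e')) ≢ c (right (lift e'))
          lift-proper (Incidence.link _ _ k≢l _ (f , cf , _) (g , cg , _)) cf≡cg = k≢l (sym cf ∙ (cf≡cg ∙ cg))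

          boundary-b : ∀ J' → boundary (map lift J') b ≡ false
          boundary-b [] = refl
          boundary-b (e' ∷ J') = cong₂ _xor_ (¬-not λ p → lift-proper e' (loop-at-b (lift e') p)) (boundary-b J')

          Ub : U b ≡ true
          Ub = cong₂ _xor_ (boundary-b J') Tb

          pick : ∀ x → U x ∧ not (δ x b) ≡ true → ∃ λ s → Spoke.foot s ≡ x
          pick x p with ∧-true {U x} p
          ... | Ux , x≢b with x ≟ b
          ...   | no x≢b with near? x
          ...     | no far = ⊥-elim (true≢false Ux (sym (fibre-far U x far) ∙ U-even x))
          ...     | yes (inj₁ x≡b) = ⊥-elim (x≢b x≡b)
          ...     | yes near@(inj₂ (v , Ab , Ax)) =
            spoke x (¬-not λ Tx → D-far x (T⊆D x Tx) x≢b near) (link b x (x≢b ∘ sym) v Ab Ax) (λ _ → refl) , refl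

          feet = collect (λ x → U x ∧ not (δ x b)) (λ x → proj₁ ∘ pick x)

          ∂L : IsJoin (λ v → (T v xor δ v b) xor spokes feet v) L
          ∂L v = sym (cancel (T v) _) ∙ (cong (T v xor_) (xor-comm (T v) (boundary L v) ∙ U-split) ∙
                 (sym (xor-assoc (T v) (δ v b) _) ∙ cong ((T v xor δ v b) xor_) (sym spokes≡)))
            where
            spokes≡ : spokes feet v ≡ U v ∧ not (δ v b)
            spokes≡ = xorSum-collect _ (λ x → proj₁ ∘ pick x) (λ s → δ v (Spoke.foot s)) (δ v)
                        (λ x p → cong (δ v) (proj₂ (pick x p))) ∙
                      (·-comm (λ x → U x ∧ not (δ x b)) _ ∙ sum-δ v _)
            U-split : U v ≡ δ v b xor (U v ∧ not (δ v b))
            U-split with v ≟ b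
            ... | yes refl = Ub ∙ sym (cong not (∧-zeroʳ (U v)))
            ... | no _ = sym (∧-identityʳ (U v))

      grow : ∀ j → (∀ J' → Incidence.IsJoin A' (fibreSum T) J' → j ≤ suc (length J')) →
             (∃ λ J → IsJoin T J × length J ≡ j) → Bound A' (fibreSum T) D → Bound A T D
      grow j lifts (J , ∂J , |J|≡j) bound t ν joins packings = begin
        t + 2                       ≤⟨ +-monoˡ-≤ 2 (m≤n+m∸n t 1) ⟩
        suc ((t ∸ 1) + 2)           ≤⟨ s≤s (bound (t ∸ 1) (ν ∸ 1) joins' packings') ⟩
        -- The ball alone is a packing, hence ν ≥ 1 and the truncated subtraction is exact.
        suc (ν ∸ 1) + 2 * countF D  ≡⟨ cong (_+ 2 * countF D) (m+[n∸m]≡n (packings 1 (grow-packing (Cuts.empty A')))) ⟩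
        ν + 2 * countF D            ∎
        where
        open ≤-Reasoning
        joins' : ∀ J' → Incidence.IsJoin A' (fibreSum T) J' → t ∸ 1 ≤ length J'
        joins' J' ∂J' = ∸-monoˡ-≤ 1 (≤-trans (joins J ∂J) (≤-trans (≤-reflexive |J|≡j) (lifts J' ∂J')))
        packings' : ∀ s → Cuts.Packing A' (fibreSum T) D s → s ≤ ν ∸ 1
        packings' s P = ∸-monoˡ-≤ 1 (packings (suc s) (grow-packing P))

  -- The measure is the number of deadly faces plus the length of some T-join, not necessarily a
  -- shortest one. Merging lowers the first summand; growing lowers the second, as a T-join has a
  -- link at `b`, which becomes a loop.
  bound : ∀ n A → (∀ f v → Dec (A f v)) → ∀ T D → (∀ f → T f ≡ true → D f ≡ true) → (∃ λ f → D f ≡ true) →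
          ∀ J → Incidence.IsJoin A T J → countF D + length J ≤ n → Bound A T D
  bound n A A? T D T⊆D (d , Dd) J ∂J size t ν joins packings with any? (λ f → T f ≟ᵇ true)
  -- The empty join gives t ≤ 0, and one deadly face accounts for the 2.
  ... | no T≡∅ = ≤-trans (+-mono-≤ (joins [] λ v → sym (¬-not λ Tv → T≡∅ (v , Tv))) (*-monoʳ-≤ 2 (countF-pos d Dd)))
                         (m≤n+m _ ν)
  bound zero A A? T D T⊆D (d , Dd) J ∂J size t ν joins packings | yes _ =
    ⊥-elim (<⇒≱ (countF-pos {p = D} d Dd) (≤-trans (m≤m+n _ _) size))
  bound (suc n) A A? T D T⊆D (d , Dd) J ∂J size t ν joins packings | yes (b₀ , Tb₀)
    with any? (λ f → any? λ g → (D f ≟ᵇ true) ×-dec ((D g ≟ᵇ true) ×-dec (¬? (f ≟ g) ×-dec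
               any? (λ h → share? f h ×-dec share? h g))))
    where
    share? : ∀ f g → Dec (∃ λ v → A f v × A g v)
    share? f g = any? λ v → A? f v ×-dec A? g v
  ... | yes (f , g , close) =
    merge (bound n A' (contract? A?) (fibreSum T) D' (fibreSum-⊆ D⊆D' T⊆D) (c d , D⊆D' d Dd) (mapMaybe push J)
             (λ k → boundary-push J k ∙ sum-cong (λ f → cong (_∧ δ k (c f)) (∂J f)))
             (≤-pred (≤-trans (+-mono-≤ fewer (length-mapMaybe push J)) size))) t ν joins packings
    where open Merge A T D T⊆D close
  -- The goal is a decidable inequality, so both shortest joins may be chosen under double negation.
  ... | no none = decidable-stable (_ ≤? _) λ fails →
    ¬¬-minimal {∃ (IsJoin T)} (length ∘ proj₁) (J , ∂J) λ { ((Jₘ , ∂Jₘ) , Jₘ-min) →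
    ¬¬-minimal {∃ λ a → ∃ λ b → ∃ λ J₀ → T b ≡ true × IsJoin (λ v → T v xor (δ v a xor δ v b)) J₀}
      (λ x → length (proj₁ (proj₂ (proj₂ x))))
      -- With equal terminals T + a + b is T itself, so the given T-join shows that there is
      -- something to minimise.
      (b₀ , b₀ , J , Tb₀ , λ v → ∂J v ∙ sym (cong (T v xor_) (xor-same (δ v b₀)) ∙ xor-identityʳ (T v)))
      λ { ((a , b , J₀ , Tb , ∂J₀) , J₀-min) →
    let open Grow A T D T⊆D A? (λ f g close → none (f , g , close)) b Tb
    in fails (grow (length Jₘ)
      (join-lift a J₀ ∂J₀ (λ a' b' J Tb' ∂ → J₀-min (a' , b' , J , Tb' , ∂)) (length Jₘ) (λ J ∂ → Jₘ-min (J , ∂))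
         (sym (sum-cong ∂J) ∙ boundary-even J))
      (Jₘ , ∂Jₘ , refl)
      (bound n A' (contract? A?) (fibreSum T) D (fibreSum-⊆ D⊆D' T⊆D) (d , Dd) (mapMaybe push J)
             (λ k → boundary-push J k ∙ sum-cong (λ f → cong (_∧ δ k (c f)) (∂J f)))
             (≤-pred (≤-trans (≤-reflexive (sym (+-suc (countF D) _)))
                     (≤-trans (+-monoʳ-≤ (countF D) (push-shrinks J ∂J)) size))))
      t ν joins packings) } }
    where open Incidence A

-- Parity, and odd cycles inside even edge sets.

toℕ-mod : ∀ a k → toℕ (a mod suc k) ≡ a % suc k
toℕ-mod a k = toℕ-fromℕ< (m%n<n a (suc k))

sum-lookup : ∀ {E : Set} (f : E → Bool) L → sum (f ∘ lookup L) ≡ xorSum f L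
sum-lookup f [] = sum-[] _
sum-lookup f (e ∷ L) = sum-suc _ ∙ cong (f e xor_) (sum-lookup f L)

odd? : ℕ → Bool
odd? zero = false
odd? (suc k) = not (odd? k)

odd?-+ : ∀ a b → odd? (a + b) ≡ odd? a xor odd? b
odd?-+ zero b = refl
odd?-+ (suc a) b = cong not (odd?-+ a b) ∙ not-distribˡ-xor (odd? a) (odd? b)

odd?-countF : ∀ {k} (p : Fin k → Bool) → odd? (countF p) ≡ sum p
odd?-countF {zero} p = sym (sum-[] p)
odd?-countF {suc k} p = odd?-+ (if p zero then 1 else 0) _ ∙
                        (cong₂ _xor_ (bit (p zero)) (odd?-countF (p ∘ suc)) ∙ sym (sum-suc p))
  where
  bit : ∀ b → odd? (if b then 1 else 0) ≡ b
  bit false = refl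
  bit true = refl

odd?⇒IsOdd : ∀ k → odd? k ≡ true → IsOdd k
odd?⇒IsOdd (suc zero) _ = refl
odd?⇒IsOdd (suc (suc k)) h = odd?⇒IsOdd k (sym (not-involutive (odd? k)) ∙ h)

IsOdd⇒odd? : ∀ k → IsOdd k → odd? k ≡ true
IsOdd⇒odd? (suc zero) _ = refl
IsOdd⇒odd? (suc (suc k)) h = not-involutive (odd? k) ∙ IsOdd⇒odd? k h

IsOdd-sum : ∀ {k} (p : Fin k → Bool) → sum p ≡ true → IsOdd (countF p)
IsOdd-sum p h = odd?⇒IsOdd (countF p) (odd?-countF p ∙ h)

module _ {k : ℕ} {E : Set} (s t : E → Fin k) (s≢t : ∀ e → s e ≢ t e) where

  open Trails s t s≢t

  _++ᵗ_ : ∀ {x y z L M} → Trail x L y → Trail y M z → Trail x (L ++ M) z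
  [] ++ᵗ w' = w'
  step j w ++ᵗ w' = step j (w ++ᵗ w')

  vertexAt : ∀ {x L y} → Trail x L y → ℕ → Fin k
  vertexAt {x} w zero = x
  vertexAt {x} [] (suc i) = x
  vertexAt (step j w) (suc i) = vertexAt w i

  vertexAt-end : ∀ {x L y} (w : Trail x L y) → vertexAt w (length L) ≡ y
  vertexAt-end [] = refl
  vertexAt-end (step j w) = vertexAt-end w

  joinedAt : ∀ {x L y} (w : Trail x L y) (i : Fin (length L)) →
             Joined (lookup L i) (vertexAt w (toℕ i)) (vertexAt w (suc (toℕ i)))
  joinedAt (step j w) zero = j
  joinedAt (step j w) (suc i) = joinedAt w i

  cutAt : ∀ {x L y} (w : Trail x L y) (i : Fin (length L)) →
          ∃ λ B → ∃ λ C → L ≡ B ++ C × Trail x B (vertexAt w (toℕ i)) × Trail (vertexAt w (toℕ i)) C y × 1 ≤ length C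
  cutAt (step {e = e} {L} j w) zero = [] , e ∷ L , refl , [] , step j w , s≤s z≤n
  cutAt (step {e = e} j w) (suc i) =
    let B , C , eq , u , v , l = cutAt w i in e ∷ B , C , cong (e ∷_) eq , step j u , v , l

  Simple : ∀ {x L y} → Trail x L y → Set
  Simple {L = L} w = ∀ (i j : Fin (length L)) → vertexAt w (toℕ i) ≡ vertexAt w (toℕ j) → i ≡ j

  Detour : Fin k → List E → Fin k → Set
  Detour x L y = ∃ λ u → ∃ λ A → ∃ λ B → ∃ λ C → L ≡ A ++ B ++ C × Trail x A u × Trail u B u × Trail u C y
                 × 1 ≤ length B × 1 ≤ length C

  simple? : ∀ {x L y} (w : Trail x L y) → Simple w ⊎ Detour x L y
  simple? [] = inj₁ λ ()
  simple? {x} (step {e = e} j w) with simple? w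
  ... | inj₂ (u , A , B , C , eq , a , b , c , lB , lC) =
        inj₂ (u , e ∷ A , B , C , cong (e ∷_) eq , step j a , b , c , lB , lC)
  ... | inj₁ simple with any? (λ i → x ≟ vertexAt w (toℕ i))
  ...   | yes (i , x≡) =
          let B , C , eq , b , c , lC = cutAt w i
          in inj₂ (x , [] , e ∷ B , C , cong (e ∷_) eq , [] , step j (subst (Trail _ B) (sym x≡) b) ,
                   subst (λ u → Trail u C _) (sym x≡) c , s≤s z≤n , lC)
  ...   | no fresh = inj₁ λ { zero zero _ → refl
                            ; zero (suc i) p → ⊥-elim (fresh (i , p))
                            ; (suc i) zero p → ⊥-elim (fresh (i , sym p))
                            ; (suc i) (suc i') p → cong suc (simple i i' p) }

  module _ (wt : E → Bool) where

    OddClosed : Set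
    OddClosed = ∃ λ x → ∃ λ L → Trail x L x × xorSum wt L ≡ true

    -- Without `e`, the two ends of `e` are the only odd vertices, so a trail in the rest closes `e`
    -- up. If this closed trail has even weight, what remains after its removal is still even at
    -- every vertex and has odd weight.
    oddClosedTrail : ∀ n L → length L ≤ n → (∀ v → boundary L v ≡ false) → xorSum wt L ≡ true → OddClosed
    oddClosedTrail (suc n) (e ∷ L) (s≤s len) even odd = close (extractTrail L (t e) (rest (t e) ∙ odd-t))
      where
      odd-t : ends (t e) e ≡ true
      odd-t = cong₂ _xor_ (δ-≢ (s≢t e ∘ sym)) (δ-refl (t e))
      rest : ∀ v → boundary L v ≡ ends v e
      rest v = sym (xor-cancel {ends v e} (even v))
      close : OddTrail L (t e) → OddClosed
      close (y , y≢t , oddy , X , R , w , p) with xor-true {δ y (s e)} (sym (rest y) ∙ oddy)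
      ... | inj₂ y≡t = ⊥-elim (y≢t (δ-true {i = y} {t e} y≡t))
      ... | inj₁ y≡s with refl ← δ-true {i = y} {s e} y≡s with xorSum wt (e ∷ X) in eq
      ...   | true = s e , e ∷ X , step (inj₁ (refl , refl)) w , eq
      ...   | false = oddClosedTrail n R
          (≤-trans (≤-trans (m≤n+m _ (length X)) (≤-reflexive (sym (↭-length p ∙ length-++ X)))) len)
          (λ v → remaining v (boundary-↭ p v ∙ boundary-++ X R v))
          (sym (cong (_xor xorSum wt R) eq) ∙ (xor-assoc (wt e) _ _ ∙
            (cong (wt e xor_) (sym (xorSum-↭ wt p ∙ xorSum-++ wt X R)) ∙ odd)))
        where
        remaining : ∀ v → boundary L v ≡ boundary X v xor boundary R v → boundary R v ≡ false
        remaining v eq' = sym (cancel (boundary X v) (boundary R v)) ∙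
          (cong₂ _xor_ (boundary-Trail w v ∙ xor-comm (δ v (t e)) _) (sym eq' ∙ rest v) ∙ xor-same (ends v e))

    -- A repeated vertex splits off a closed detour, and either the detour or what is left has odd
    -- weight. `Detour` asks B and C to be nonempty so that both pieces are shorter.
    simpleOddClosed : ∀ n x L → length L ≤ n → (w : Trail x L x) → xorSum wt L ≡ true →
                      ∃ λ x → ∃ λ L → Σ (Trail x L x) λ w → Simple w × xorSum wt L ≡ true
    simpleOddClosed zero x [] len w ()
    simpleOddClosed (suc n) x L len w odd with simple? w
    ... | inj₁ simple = x , L , w , simple , odd
    ... | inj₂ (u , A , B , C , refl , a , b , c , lB , lC) with xorSum wt B in eqB
    ...   | true = simpleOddClosed n u B (≤-pred (≤-trans shorter len)) b eqB
      where
      shorter : suc (length B) ≤ length (A ++ B ++ C)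
      shorter = begin
        suc (length B)               ≡⟨ +-comm 1 (length B) ⟩
        length B + 1                 ≤⟨ +-monoʳ-≤ (length B) lC ⟩
        length B + length C          ≤⟨ m≤n+m _ (length A) ⟩
        length A + (length B + length C) ≡⟨ sym (length-++ A ∙ cong (length A +_) (length-++ B)) ⟩
        length (A ++ B ++ C)         ∎
        where open ≤-Reasoning
    ...   | false = simpleOddClosed n x (A ++ C) (≤-pred (≤-trans shorter len)) (a ++ᵗ c)
        (xorSum-++ wt A C ∙ (cong (xorSum wt A xor_) (sym (xorSum-++ wt B C ∙ cong (_xor xorSum wt C) eqB)) ∙
         (sym (xorSum-++ wt A (B ++ C)) ∙ odd)))
      where
      shorter : suc (length (A ++ C)) ≤ length (A ++ B ++ C)
      shorter = begin
        suc (length (A ++ C))            ≡⟨ cong suc (length-++ A) ⟩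
        suc (length A + length C)        ≡⟨ sym (+-suc (length A) (length C)) ⟩
        length A + suc (length C)        ≤⟨ +-monoʳ-≤ (length A) (+-monoˡ-≤ (length C) lB) ⟩
        length A + (length B + length C) ≡⟨ sym (length-++ A ∙ cong (length A +_) (length-++ B)) ⟩
        length (A ++ B ++ C)             ∎
        where open ≤-Reasoning

module _ (G : SignedGraph) (c : Fin (SignedGraph.m G) → Bool) where

  open SignedGraph G

  private
    E : Set
    E = ∃ λ e → c e ≡ true

    s t : E → Fin n
    s (e , _) = end e false
    t (e , _) = end e true

    wt : E → Bool
    wt = odd ∘ proj₁

  open Trails s t (noLoop ∘ proj₁)

  toCycle : ∀ {x e₀ e₁ e₂ L} (w : Trail x (e₀ ∷ e₁ ∷ e₂ ∷ L) x) → Simple s t (noLoop ∘ proj₁) w → Cycle G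
  toCycle {x} {e₀} {e₁} {e₂} {L} w simple = record
    { l = length L
    ; vs = vertexAt _ _ _ w ∘ toℕ
    ; vsInj = simple
    ; es = proj₁ ∘ lookup X
    ; join = λ i → subst (Joins G (proj₁ (lookup X i)) (vertexAt _ _ _ w (toℕ i))) (next i) (joinedAt _ _ _ w i)
    }
    where
    X = e₀ ∷ e₁ ∷ e₂ ∷ L
    k = 2 + length L
    next : ∀ (i : Fin (suc k)) → vertexAt _ _ _ w (suc (toℕ i)) ≡ vertexAt _ _ _ w (toℕ (suc (toℕ i) mod suc k))
    next i with m≤n⇒m<n∨m≡n (toℕ<n i)
    ... | inj₁ lt = cong (vertexAt _ _ _ w) (sym (toℕ-mod (suc (toℕ i)) k ∙ m<n⇒m%n≡m lt))
    ... | inj₂ eq = cong (vertexAt _ _ _ w) eq ∙ (vertexAt-end _ _ _ w ∙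
                    cong (vertexAt _ _ _ w) 
                      (sym (cong (λ a → toℕ (a mod suc k)) eq ∙ (toℕ-mod (suc k) k ∙ n%n≡0 (suc k)))))

  evenEdgeSet⇒oddCycle : (∀ v → c · (λ e → δ v (end e false) xor δ v (end e true)) ≡ false) → c · odd ≡ true →
                  ∃ λ C → OddCycle G C × ∀ i → c (Cycle.es C i) ≡ true
  evenEdgeSet⇒oddCycle even total =
    let x , L , w , o = oddClosedTrail s t (noLoop ∘ proj₁) wt (length edges) edges ≤-refl
                          (λ v → xorSum-collect c _ (ends v) _ (λ _ _ → refl) ∙ even v)
                          (xorSum-collect c _ wt odd (λ _ _ → refl) ∙ total)
    in build (simpleOddClosed s t (noLoop ∘ proj₁) wt (suc (length L)) x L (n≤1+n _) w o)
    where
    edges : List E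
    edges = collect c _,_

    build : (∃ λ x → ∃ λ L → Σ (Trail x L x) λ w → Simple s t (noLoop ∘ proj₁) w × xorSum wt L ≡ true) →
            ∃ λ C → OddCycle G C × ∀ i → c (Cycle.es C i) ≡ true
    build (x , e ∷ [] , step j [] , _ , o) = ⊥-elim (noLoop (proj₁ e) (loop j))
      where
      loop : Joined e x x → s e ≡ t e
      loop (inj₁ (p , q)) = p ∙ sym q
      loop (inj₂ (p , q)) = p ∙ sym q
    -- `Simple` separates vertices only, so the two edges may coincide, and then their total weight
    -- is even; otherwise they are parallel.
    build (x , e ∷ e' ∷ [] , step j (step j' []) , _ , o) with proj₁ e ≟ proj₁ e'
    ... | yes refl = ⊥-elim (true≢false o (cong (wt e xor_) (xor-identityʳ (wt e)) ∙ xor-same (wt e)))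
    ... | no e≢e' = ⊥-elim (noMulti (proj₁ e) (proj₁ e') e≢e' (parallel j j'))
      where
      parallel : ∀ {x y} → Joined e x y → Joined e' y x → (s e ≡ s e' × t e ≡ t e') ⊎ (s e ≡ t e' × t e ≡ s e')
      parallel (inj₁ (p , q)) (inj₁ (p' , q')) = inj₂ (p ∙ sym q' , q ∙ sym p')
      parallel (inj₁ (p , q)) (inj₂ (p' , q')) = inj₁ (p ∙ sym p' , q ∙ sym q')
      parallel (inj₂ (p , q)) (inj₁ (p' , q')) = inj₁ (p ∙ sym p' , q ∙ sym q')
      parallel (inj₂ (p , q)) (inj₂ (p' , q')) = inj₂ (p ∙ sym q' , q ∙ sym p')
    build (x , X@(_ ∷ _ ∷ _ ∷ _) , w , simple , o) =
      toCycle w simple , IsOdd-sum (wt ∘ lookup X) (sum-lookup wt X ∙ o) , proj₂ ∘ lookup X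

module _ (G : SignedGraph) where

  open SignedGraph G

  -- The sum telescopes: the second ends are the first ends rotated by one place.
  parity-cycle : ∀ (C : Cycle G) x → sum (λ i → x (end (Cycle.es C i) false) xor x (end (Cycle.es C i) true)) ≡ false
  parity-cycle C x = begin
    sum (λ i → x (end (es i) false) xor x (end (es i) true))  ≡⟨ sum-cong (λ i → endpoints (join i)) ⟩
    sum (λ i → x (vs i) xor x (vs (suc (toℕ i) mod suc k)))   ≡⟨ sum-distrib-xor _ _ ⟩
    sum (x ∘ vs) xor sum (λ i → x (vs (suc (toℕ i) mod suc k))) ≡⟨ cong (sum (x ∘ vs) xor_) (rotate (x ∘ vs)) ⟩
    sum (x ∘ vs) xor sum (x ∘ vs)                             ≡⟨ xor-same (sum (x ∘ vs)) ⟩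
    false                                                     ∎
    where
    open ≡-Reasoning
    open Cycle C
    k = 2 + l

    endpoints : ∀ {e u v} → Joins G e u v → x (end e false) xor x (end e true) ≡ x u xor x v
    endpoints (inj₁ (refl , refl)) = refl
    endpoints {e} (inj₂ (refl , refl)) = xor-comm (x (end e false)) _

    rotate : ∀ (h : Fin (suc k) → Bool) → sum (λ i → h (suc (toℕ i) mod suc k)) ≡ sum h
    rotate h = sum-init-last _ ∙ (cong₂ _xor_ (sum-cong (cong h ∘ next)) (cong h last) ∙
               (xor-comm (sum (h ∘ suc)) (h zero) ∙ sym (sum-suc h)))
      where
      next : ∀ (i : Fin k) → suc (toℕ (inject₁ i)) mod suc k ≡ suc i
      next i = toℕ-injective (toℕ-mod (suc (toℕ (inject₁ i))) k ∙
        (m<n⇒m%n≡m (s≤s (≤-trans (≤-reflexive (cong suc (toℕ-inject₁ i))) (toℕ<n i))) ∙ cong suc (toℕ-inject₁ i)))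
      last : suc (toℕ (fromℕ k)) mod suc k ≡ zero
      last = toℕ-injective (toℕ-mod (suc (toℕ (fromℕ k))) k ∙
        (cong (λ a → suc a % suc k) (toℕ-fromℕ k) ∙ n%n≡0 (suc k)))

anyF-true : ∀ {k} (p : Fin k → Bool) i → p i ≡ true → anyF p ≡ true
anyF-true p zero h = cong (_∨ anyF (p ∘ suc)) h
anyF-true p (suc i) h = cong (p zero ∨_) (anyF-true (p ∘ suc) i h) ∙ ∨-zeroʳ (p zero)

-- Borders of sets of faces, and Euler's formula.

module Plane (G : PlaneSignedGraph) where

  open PlaneSignedGraph G
  open xor-∧-Solver

  left right : Fin m → Fin F
  left e = faceOfDart (e , false)
  right e = faceOfDart (e , true)

  α-involutive : ∀ d → α (α d) ≡ d
  α-involutive (e , b) = cong (e ,_) (not-involutive b)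

  face-σ : ∀ d → faceOfDart (α d) ≡ faceOfDart (σ d)
  face-σ d = cong faceOf (sym (walk-φ (α d))) ∙ cong (faceOfDart ∘ σ) (α-involutive d)

  sumDart : (Dart → Bool) → Bool
  sumDart g = sum λ e → g (e , false) xor g (e , true)

  private
    dart : Fin (m + m) → Dart
    dart i = [ _, false , _, true ] (splitAt m i)

    index : Dart → Fin (m + m)
    index (e , false) = e ↑ˡ m
    index (e , true) = m ↑ʳ e

    dart-index : ∀ d → dart (index d) ≡ d
    dart-index (e , false) = cong [ _, false , _, true ] (splitAt-↑ˡ m e m)
    dart-index (e , true) = cong [ _, false , _, true ] (splitAt-↑ʳ m m e)

    index-dart : ∀ i → index (dart i) ≡ i
    index-dart i = onSum (splitAt m i) ∙ join-splitAt m m i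
      where
      onSum : ∀ x → index ([ _, false , _, true ] x) ≡ joinFin m m x
      onSum (inj₁ _) = refl
      onSum (inj₂ _) = refl

    sum-dart : ∀ g → sum (g ∘ dart) ≡ sumDart g
    sum-dart g = sum-↑ m (g ∘ dart) ∙
      (cong₂ _xor_ (sum-cong λ e → cong g (dart-index (e , false))) (sum-cong λ e → cong g (dart-index (e , true))) ∙
       sym (sum-distrib-xor (λ e → g (e , false)) (λ e → g (e , true))))

    σ-permutation : Permutation′ (m + m)
    σ-permutation = permutation (index ∘ σ ∘ dart) (index ∘ σ⁻¹ ∘ dart)
      (λ i → cong (index ∘ σ) (dart-index (σ⁻¹ (dart i))) ∙ (cong index (σσ⁻¹ (dart i)) ∙ index-dart i))
      (λ i → cong (index ∘ σ⁻¹) (dart-index (σ (dart i))) ∙ (cong index (σ⁻¹σ (dart i)) ∙ index-dart i))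

  sumDart-σ : ∀ g → sumDart (g ∘ σ) ≡ sumDart g
  sumDart-σ g = begin
    sumDart (g ∘ σ)                        ≡⟨ sym (sum-dart (g ∘ σ)) ⟩
    sum (g ∘ σ ∘ dart)                     ≡⟨ sum-cong (λ i → cong g (sym (dart-index (σ (dart i))))) ⟩
    sum (g ∘ dart ∘ index ∘ σ ∘ dart)      ≡⟨ sum-permute (g ∘ dart) σ-permutation ⟩
    sum (g ∘ dart)                         ≡⟨ sum-dart g ⟩
    sumDart g                              ∎
    where open ≡-Reasoning

  coboundary : (Fin n → Bool) → Fin m → Bool
  coboundary x e = x (end e false) xor x (end e true)

  border : (Fin F → Bool) → Fin m → Bool
  border z e = z (left e) xor z (right e)

  -- Going round a vertex, the darts at which z changes come in pairs.
  border⊥coboundary : ∀ z x → border z · coboundary x ≡ false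
  border⊥coboundary z x = begin
    border z · coboundary x
      ≡⟨ sum-cong (λ e → regroup (z (left e)) (z (right e)) (x (end e false)) (x (end e true))) ⟩
    sumDart (λ d → x (tail d) ∧ (z (faceOfDart d) xor z (faceOfDart (α d))))
      ≡⟨ sum-cong (λ e → spread (e , false) (e , true)) ⟩
    sum (λ e → (g (e , false) xor g (e , true)) xor (g' (e , false) xor g' (e , true)))
      ≡⟨ sum-distrib-xor _ _ ⟩
    sumDart g xor sumDart g'
      ≡⟨ cong (sumDart g xor_) (sum-cong (λ e → cong₂ _xor_ (g'≡ (e , false)) (g'≡ (e , true))) ∙ sumDart-σ g) ⟩
    sumDart g xor sumDart g
      ≡⟨ xor-same (sumDart g) ⟩
    false ∎
    where
    open ≡-Reasoning
    g g' : Dart → Bool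
    g d = x (tail d) ∧ z (faceOfDart d)
    g' d = x (tail d) ∧ z (faceOfDart (α d))
    g'≡ : ∀ d → g' d ≡ g (σ d)
    g'≡ d = cong₂ (λ v f → x v ∧ z f) (sym (σ-tail d)) (face-σ d)
    regroup : ∀ l r u v → (l xor r) ∧ (u xor v) ≡ (u ∧ (l xor r)) xor (v ∧ (r xor l))
    regroup = solve 4 (λ l r u v → (l :+ r) :* (u :+ v) := (u :* (l :+ r)) :+ (v :* (r :+ l))) refl
    interchange : ∀ a b c d → (a xor b) xor (c xor d) ≡ (a xor c) xor (b xor d)
    interchange = solve 4 (λ a b c d → (a :+ b) :+ (c :+ d) := (a :+ c) :+ (b :+ d)) refl
    spread : ∀ (d d' : Dart) → (x (tail d) ∧ (z (faceOfDart d) xor z (faceOfDart (α d)))) xor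
                      (x (tail d') ∧ (z (faceOfDart d') xor z (faceOfDart (α d')))) ≡
                      (g d xor g d') xor (g' d xor g' d')
    spread d d' = cong₂ _xor_ (∧-distribˡ-xor (x (tail d)) _ _) (∧-distribˡ-xor (x (tail d')) _ _) ∙
                  interchange (g d) (g' d) (g d') (g' d')

  dartAt? : ∀ {P : Dart → Set} → (∀ d → Dec (P d)) → Dec (∃ P)
  dartAt? P? = map′ (λ { (e , inj₁ p) → (e , false) , p ; (e , inj₂ p) → (e , true) , p })
                    (λ { ((e , false) , p) → e , inj₁ p ; ((e , true) , p) → e , inj₂ p })
                    (any? λ e → P? (e , false) ⊎-dec P? (e , true))

  isolated⇒no-dart : ∀ v → isolatedB v ≡ true → ∀ d → tail d ≢ v
  isolated⇒no-dart v iso (e , b) p = true≢false (found b p) (sym (not-involutive _) ∙ cong not iso)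
    where
    at : Dart → Bool
    at d = ⌊ tail d ≟ v ⌋
    δ-≡ : ∀ {u} → u ≡ v → δ u v ≡ true
    δ-≡ refl = δ-refl v
    found : ∀ b → end e b ≡ v → anyDart at ≡ true
    found false p = cong (_∨ anyF (λ e → at (e , true))) (anyF-true (λ e → at (e , false)) e (δ-≡ p))
    found true p = cong (anyF (λ e → at (e , false)) ∨_) (anyF-true (λ e → at (e , true)) e (δ-≡ p)) ∙ ∨-zeroʳ _

  around : ∀ (z : Fin F → Bool) v → (∀ d → tail d ≡ v → z (faceOfDart d) ≡ z (faceOfDart (α d))) →
           ∀ d d' → tail d ≡ v → tail d' ≡ v → z (faceOfDart d) ≡ z (faceOfDart d')
  around z v agree d d' p p' with σ-cyclic d d' (p ∙ sym p')
  ... | k , refl = go k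
    where
    tail-iter : ∀ k → tail (iter σ k d) ≡ v
    tail-iter zero = p
    tail-iter (suc k) = σ-tail _ ∙ tail-iter k
    go : ∀ k → z (faceOfDart d) ≡ z (faceOfDart (iter σ k d))
    go zero = refl
    go (suc k) = go k ∙ (agree _ (tail-iter k) ∙ cong z (face-σ (iter σ k d)))

  border-zero : ∀ (z : Fin F → Bool) → (∀ e → border z e ≡ false) → ∀ d → z (faceOfDart d) ≡ z (faceOfDart (α d))
  border-zero z h (e , false) = xor-cancel (h e)
  border-zero z h (e , true) = sym (xor-cancel (h e))

  -- Connectedness of the dual. The value of z is constant around each vertex, hence on each
  -- component, where `val` at a representative records it, and the incidence tree of components and
  -- faces carries it to all faces.
  border-zero⇒constant : ∀ (z : Fin F → Bool) → (∀ e → border z e ≡ false) → ∀ f g → z f ≡ z g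
  border-zero⇒constant z h f g = treeConn [ (λ k → val (proj₁ (comp-surj k))) , z ]
    (λ d → val-root (tail d) ∙ val-dart d) (λ v iso → val-root v ∙ val-isolated v iso) (inj₂ f) (inj₂ g)
    where
    across = border-zero z h

    dartFrom? : ∀ v → Dec (∃ λ d → tail d ≡ v)
    dartFrom? v = dartAt? λ d → tail d ≟ v

    val : Fin n → Bool
    val v with dartFrom? v
    ... | yes (d , _) = z (faceOfDart d)
    ... | no _ = z (faceIso v)

    val-dart : ∀ d → val (tail d) ≡ z (faceOfDart d)
    val-dart d with dartFrom? (tail d)
    ... | yes (d' , p) = around z (tail d) (λ d _ → across d) d' d p refl
    ... | no none = ⊥-elim (none (d , refl))

    val-isolated : ∀ v → isolatedB v ≡ true → val v ≡ z (faceIso v)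
    val-isolated v iso with dartFrom? v
    ... | yes (d , p) = ⊥-elim (isolated⇒no-dart v iso d p)
    ... | no _ = refl

    val-root : ∀ v → val (proj₁ (comp-surj (comp v))) ≡ val v
    val-root v = comp-conn val (λ e → val-dart (e , false) ∙ (across (e , false) ∙ sym (val-dart (e , true))))
                   _ v (proj₂ (comp-surj (comp v)))

  incidence : Fin m → Fin F → Bool
  incidence e f = δ f (left e) xor δ f (right e)

  ·-incidence : ∀ z e → z · incidence e ≡ border z e
  ·-incidence z e = ·-distribˡ z (λ f → δ f (left e)) (λ f → δ f (right e)) ∙ cong₂ _xor_ (·-δ z (left e)) (·-δ z (right e))

  -- By Euler's formula every vector orthogonal to all coboundaries is the border of a set of faces:
  -- otherwise an obstruction y is independent of the coboundaries and, like them, orthogonal to all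
  -- face boundaries, and then there are more independent vectors than edges.
  cycle⇒border : Fin F → ∀ c → (∀ x → c · coboundary x ≡ false) → ∃ λ z → ∀ e → border z e ≡ c e
  cycle⇒border f₀ c c⊥ with fredholm (λ f e → incidence e f) c
  ... | inj₁ (z , p) = z , λ e → sym (·-incidence z e) ∙ p e
  ... | inj₂ (y , y⊥ , yc) = ⊥-elim (<⇒≱ (≤-reflexive (cong suc (sym size))) (dimension-≤ Φ injective))
    where
    -- Euler's formula for C components, by eliminating W + I between `euler` and `treeCount`.
    size : n + F ≡ suc (m + C)
    size = +-cancelʳ-≡ (W + countF isolatedB + C) _ _ (begin
      (n + F) + (W + I + C)     ≡⟨ arith₁ n F W I C ⟩
      (n + W + I) + (C + F)     ≡⟨ cong₂ _+_ euler (sym treeCount) ⟩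
      (2 * C + m) + (W + I + 1) ≡⟨ arith₂ C m W I ⟩
      suc (m + C) + (W + I + C) ∎)
      where
      open ≡-Reasoning
      open +-*-Solver renaming (solve to solveℕ; _:+_ to _⊕_; _:*_ to _⊗_; _:=_ to _⊜_; con to conℕ)
      I = countF isolatedB
      arith₁ : ∀ n F W I C → (n + F) + (W + I + C) ≡ (n + W + I) + (C + F)
      arith₁ = solveℕ 5 (λ n F W I C → (n ⊕ F) ⊕ (W ⊕ I ⊕ C) ⊜ (n ⊕ W ⊕ I) ⊕ (C ⊕ F)) refl
      arith₂ : ∀ C m W I → (2 * C + m) + (W + I + 1) ≡ suc (m + C) + (W + I + C)
      arith₂ = solveℕ 4 (λ C m W I → (conℕ 2 ⊗ C ⊕ m) ⊕ (W ⊕ I ⊕ conℕ 1) ⊜ (conℕ 1 ⊕ (m ⊕ C)) ⊕ (W ⊕ I ⊕ C)) refl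

    -- Only face vectors of even total are boundaries of edge sets, so the value at `f₀` is
    -- adjusted; `Φ` keeps the original value separately.
    balance : (Fin F → Bool) → Fin F → Bool
    balance w f = w f xor (sum w ∧ δ f f₀)

    balanced : ∀ w → sum (balance w) ≡ false
    balanced w = sum-distrib-xor w _ ∙
      (cong (sum w xor_) (∧-distribˡ-sum (sum w) _ ∙ (cong (sum w ∧_) (sum-δ-true f₀) ∙ ∧-identityʳ _)) ∙ xor-same (sum w))

    -- An obstruction has zero border, so it is constant and pairs to zero with a vector of even
    -- total.
    fill : ∀ w → Solution incidence (balance w)
    fill w with fredholm incidence (balance w)
    ... | inj₁ solution = solution
    ... | inj₂ (u , u⊥ , uw) = ⊥-elim (true≢false uw
            (·-cong (λ f → border-zero⇒constant u (λ e → sym (·-incidence u e) ∙ u⊥ e) f f₀) (λ _ → refl) ∙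
             (∧-distribˡ-sum (u f₀) _ ∙ (cong (u f₀ ∧_) (balanced w) ∙ ∧-zeroʳ (u f₀)))))

    -- fill need not respect pointwise equality, so it is applied to canonical representatives.
    filling : (Fin F → Bool) → Fin m → Bool
    filling w = proj₁ (fill (decode (encode w)))

    ·-filling : ∀ w f → filling w · (λ e → incidence e f) ≡ balance w f
    ·-filling w f = proj₂ (fill (decode (encode w))) f ∙
      cong₂ (λ a b → a xor (b ∧ δ f f₀)) (decode-encode w f) (sum-cong (decode-encode w))

    root : Fin C → Fin n
    root k = proj₁ (comp-surj k)

    Vec : Set
    Vec = Fin (suc (n + F)) → Bool

    xPart : Vec → Fin n → Bool
    xPart u v = u (suc (v ↑ˡ F))
    wPart : Vec → Fin F → Bool
    wPart u f = u (suc (n ↑ʳ f))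

    chain : Vec → Fin m → Bool
    chain u e = coboundary (xPart u) e xor (u zero ∧ y e)

    outputs : Vec → Fin m ⊎ Fin C → Bool
    outputs u = [ chain u ⊞ filling (wPart u) , xPart u ∘ root ]

    -- Packs 1 + n + F bits into 1 + m + C, one too few by `size`. The edge vector is a coboundary
    -- plus a multiple of `y` plus a filling; what it forgets is the value of w at `f₀` and one
    -- value of x per component.
    Φ : Vec → Fin (suc (m + C)) → Bool
    Φ u zero = wPart u f₀
    Φ u (suc i) = outputs u (splitAt m i)

    coboundary⊥ : ∀ x f → coboundary x · (λ e → incidence e f) ≡ false
    coboundary⊥ x f = ·-comm (coboundary x) _ ∙ border⊥coboundary (δ f) x

    chain⊥ : ∀ u f → chain u · (λ e → incidence e f) ≡ false
    chain⊥ u f = ·-distribʳ _ (coboundary (xPart u)) (λ e → u zero ∧ y e) ∙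
      cong₂ _xor_ (coboundary⊥ (xPart u) f)
        (sum-cong (λ e → ∧-assoc (u zero) (y e) _) ∙ (∧-distribˡ-sum (u zero) _ ∙ (cong (u zero ∧_) (y⊥ f) ∙ ∧-zeroʳ (u zero))))

    chain·c : ∀ u → chain u · c ≡ u zero
    chain·c u = ·-distribʳ c (coboundary (xPart u)) (λ e → u zero ∧ y e) ∙
      cong₂ _xor_ (·-comm (coboundary (xPart u)) c ∙ c⊥ (xPart u))
        (sum-cong (λ e → ∧-assoc (u zero) (y e) _) ∙ (∧-distribˡ-sum (u zero) _ ∙ (cong (u zero ∧_) yc ∙ ∧-identityʳ _)))

    -- Decoding in order: face boundaries see only the filling and give w; pairing with `c` then
    -- gives the coefficient of `y`; the coboundary and the roots give x.
    injective : ∀ u u' → Φ u ≗ Φ u' → u ≗ u'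
    injective u u' h = agree
      where
      edges : ∀ e → chain u e xor filling (wPart u) e ≡ chain u' e xor filling (wPart u') e
      edges e = sym (cong (outputs u) (splitAt-↑ˡ m e C)) ∙ (h (suc (e ↑ˡ C)) ∙ cong (outputs u') (splitAt-↑ˡ m e C))
      roots : ∀ k → xPart u (root k) ≡ xPart u' (root k)
      roots k = sym (cong (outputs u) (splitAt-↑ʳ m C k)) ∙ (h (suc (m ↑ʳ k)) ∙ cong (outputs u') (splitAt-↑ʳ m C k))
      boundaries : ∀ u f → (chain u ⊞ filling (wPart u)) · (λ e → incidence e f) ≡ balance (wPart u) f
      boundaries u f = ·-distribʳ _ (chain u) (filling (wPart u)) ∙ cong₂ _xor_ (chain⊥ u f) (·-filling (wPart u) f)
      balances : ∀ f → balance (wPart u) f ≡ balance (wPart u') f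
      balances f = sym (boundaries u f) ∙ (·-cong edges (λ _ → refl) ∙ boundaries u' f)
      faces : ∀ f → wPart u f ≡ wPart u' f
      faces f = [_,_] {C = λ _ → wPart u f ≡ wPart u' f}
                  (λ f≡f₀ → cong (wPart u) f≡f₀ ∙ (h zero ∙ cong (wPart u') (sym f≡f₀)))
                  (λ f≢f₀ → sym (off u f≢f₀) ∙ (balances f ∙ off u' f≢f₀)) (toSum (f ≟ f₀))
        where
        off : ∀ u → f ≢ f₀ → balance (wPart u) f ≡ wPart u f
        off u f≢f₀ = cong (wPart u f xor_) (cong (sum (wPart u) ∧_) (δ-≢ f≢f₀) ∙ ∧-zeroʳ _) ∙ xor-identityʳ _
      chains : ∀ e → chain u e ≡ chain u' e
      chains e = xor-cancelʳ (edges e ∙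
        cong (λ code → chain u' e xor proj₁ (fill (decode code)) e) (encode-cong (sym ∘ faces)))
        where
        xor-cancelʳ : ∀ {a b c} → a xor c ≡ b xor c → a ≡ b
        xor-cancelʳ {a} {b} {c} p = sym (undo a c) ∙ (cong (_xor c) p ∙ undo b c)
          where
          undo : ∀ a c → (a xor c) xor c ≡ a
          undo a c = xor-assoc a c c ∙ (cong (a xor_) (xor-same c) ∙ xor-identityʳ a)
      head : u zero ≡ u' zero
      head = sym (chain·c u) ∙ (·-cong chains (λ _ → refl) ∙ chain·c u')
      difference : Fin n → Bool
      difference v = xPart u v xor xPart u' v
      flat : ∀ e → difference (end e false) ≡ difference (end e true)
      flat e = lemma (xPart u (end e false)) (xPart u (end e true)) (xPart u' (end e false)) (xPart u' (end e true))
                 (y e) (u zero) (chains e ∙ cong (λ b → coboundary (xPart u') e xor (b ∧ y e)) (sym head))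
        where
        lemma : ∀ a b a' b' y z → (a xor b) xor (z ∧ y) ≡ (a' xor b') xor (z ∧ y) → a xor a' ≡ b xor b'
        lemma a b a' b' y z p = xor-cancel (regroup a b a' b' (z ∧ y) ∙
          (cong (_xor ((a' xor b') xor (z ∧ y))) p ∙ xor-same ((a' xor b') xor (z ∧ y))))
          where
          regroup : ∀ a b a' b' s → (a xor a') xor (b xor b') ≡ ((a xor b) xor s) xor ((a' xor b') xor s)
          regroup = solve 5 (λ a b a' b' s → (a :+ a') :+ (b :+ b') := ((a :+ b) :+ s) :+ ((a' :+ b') :+ s)) refl
      vertices : ∀ v → xPart u v ≡ xPart u' v
      vertices v = xor-cancel (comp-conn difference flat v (root (comp v)) (sym (proj₂ (comp-surj (comp v)))) ∙
                     (cong (_xor xPart u' (root (comp v))) (roots (comp v)) ∙ xor-same (xPart u' (root (comp v)))))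
      agree : u ≗ u'
      agree zero = head
      agree (suc i) = subst (λ i → u (suc i) ≡ u' (suc i)) (join-splitAt n F i) (onSum (splitAt n i))
        where
        onSum : ∀ x → u (suc (joinFin n F x)) ≡ u' (suc (joinFin n F x))
        onSum (inj₁ v) = vertices v
        onSum (inj₂ f) = faces f

-- From joins and cuts to transversals and odd cycles.

countF-cong : ∀ {k} {p q : Fin k → Bool} → p ≗ q → countF p ≡ countF q
countF-cong {zero} h = refl
countF-cong {suc k} h = cong₂ (λ b r → (if b then 1 else 0) + r) (h zero) (countF-cong (h ∘ suc))

countF-δ-suc : ∀ {k} i (p : Fin (suc k) → Bool) →
        countF (λ j → δ (suc j) (suc i) ∨ p (suc j)) ≡ countF (λ j → δ j i ∨ p (suc j))
countF-δ-suc i p = countF-cong λ j → cong (_∨ p (suc j)) (δ-inj suc (λ { refl → refl }) j i)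

countF-δ : ∀ {k} (i : Fin k) p → countF (λ j → δ j i ∨ p j) ≤ suc (countF p)
countF-δ zero p with p zero
... | true = n≤1+n _
... | false = ≤-refl
countF-δ {suc k} (suc i) p with p zero
... | true = s≤s (≤-trans (≤-reflexive (countF-δ-suc i p)) (countF-δ i (p ∘ suc)))
... | false = ≤-trans (≤-reflexive (countF-δ-suc i p)) (countF-δ i (p ∘ suc))

module Assembly (G : PlaneSignedGraph) where

  open PlaneSignedGraph G
  open Plane G

  onBoundary? : ∀ f v → Dec (OnBoundary f v)
  onBoundary? f v = dartAt? (λ d → (faceOfDart d ≟ f) ×-dec (tail d ≟ v)) ⊎-dec ((isolatedB v ≟ᵇ true) ×-dec (faceIso v ≟ f))

  oddFace : Fin F → Bool
  oddFace f = odd? (oddOnBoundary f)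

  -- An edge with the same face on both sides is counted twice on the boundary and cancels in
  -- `incidence` as well.
  oddFace-lin : ∀ f → oddFace f ≡ lin incidence odd f
  oddFace-lin f = odd?-+ (countF (λ e → ⌊ left e ≟ f ⌋ ∧ odd e)) (countF (λ e → ⌊ right e ≟ f ⌋ ∧ odd e)) ∙
    (cong₂ _xor_ (odd?-countF (λ e → ⌊ left e ≟ f ⌋ ∧ odd e)) (odd?-countF (λ e → ⌊ right e ≟ f ⌋ ∧ odd e)) ∙
     (sym (sum-distrib-xor _ _) ∙ sum-cong λ e →
        cong₂ (λ a b → (a ∧ odd e) xor (b ∧ odd e)) (δ-sym (left e) f) (δ-sym (right e) f) ∙
        (sym (∧-distribʳ-xor (odd e) (δ f (left e)) (δ f (right e))) ∙ ∧-comm (incidence e f) (odd e))))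

  ·-oddFace : ∀ z → z · oddFace ≡ border z · odd
  ·-oddFace z = ·-cong (λ _ → refl) oddFace-lin ∙ (·-lin incidence odd z ∙ (·-cong (λ _ → refl) (·-incidence z) ∙ ·-comm odd _))

  open Incidence OnBoundary hiding (left; right)
  open Cuts OnBoundary
  private
    module L = Link

  tail-left : ∀ e b → OnBoundary (faceOfDart (e , b)) (end e b)
  tail-left e b = inj₁ ((e , b) , refl , refl)

  -- The next dart in the rotation leaves the same vertex and lies on the face across the edge. Thus
  -- both faces of an edge contain both of its ends.
  tail-right : ∀ e b → OnBoundary (faceOfDart (e , not b)) (end e b)
  tail-right e b = inj₁ (σ (e , b) , sym (face-σ (e , b)) , σ-tail (e , b))

  -- An obstruction would have zero border, but its pairing with `oddFace` counts odd edges on that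
  -- border. The edges of the solution become links at one of their ends, except those with a single
  -- face on both sides, which contribute nothing.
  initialJoin : ∃ λ J → IsJoin oddFace J
  initialJoin with fredholm incidence oddFace
  ... | inj₂ (y , y⊥ , y·odd) = ⊥-elim (true≢false y·odd
        (·-oddFace y ∙ sum-zero λ e → cong (_∧ odd e) (sym (·-incidence y e) ∙ y⊥ e)))
  ... | inj₁ (x , p) = collect P dual , λ f →
        xorSum-collect P dual (ends f) (λ e → incidence e f) (λ _ _ → refl) ∙ (sum-cong (λ e → absorb f e) ∙ p f)
    where
    P : Fin m → Bool
    P e = x e ∧ not (δ (left e) (right e))
    dual : ∀ e → P e ≡ true → Link
    dual e Pe = link (left e) (right e)
                     (λ eq → true≢false (proj₂ (∧-true {x e} Pe)) (cong not (cong (δ (left e)) (sym eq) ∙ δ-refl (left e))))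
                     (end e false) (tail-left e false) (tail-right e false)
    absorb : ∀ f e → P e ∧ incidence e f ≡ x e ∧ incidence e f
    absorb f e with left e ≟ right e
    ... | no _ = cong (_∧ incidence e f) (∧-identityʳ (x e))
    ... | yes eq = cong (_∧ incidence e f) (∧-zeroʳ (x e)) ∙
                   sym (cong (x e ∧_) (cong (λ g → δ f g xor δ f (right e)) eq ∙ xor-same (δ f (right e))) ∙ ∧-zeroʳ (x e))

  touched : List Link → Fin n → Bool
  touched [] v = false
  touched (e ∷ J) v = δ v (L.via e) ∨ touched J v

  touched-size : ∀ J → countF (touched J) ≤ length J
  touched-size [] = ≤-reflexive (empty-count n)
    where
    empty-count : ∀ k → countF {k} (λ _ → false) ≡ 0
    empty-count zero = refl
    empty-count (suc k) = empty-count k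
  touched-size (e ∷ J) = ≤-trans (countF-δ (L.via e) (touched J)) (s≤s (touched-size J))

  -- Edges are counted modulo 2 along the cycle, which spares an argument that `es` has no
  -- repetitions.
  edgeParity : Cycle graph → Fin m → Bool
  edgeParity C = lin (λ i e → δ e (Cycle.es C i)) (λ _ → true)

  edgeParity-· : ∀ C g → edgeParity C · g ≡ sum (g ∘ Cycle.es C)
  edgeParity-· C g = ·-comm (edgeParity C) g ∙
    (·-lin (λ i e → δ e (Cycle.es C i)) (λ _ → true) g ∙ sum-cong (λ i → ·-δ g (Cycle.es C i)))

  -- An odd cycle C is the border of a set z of faces containing an odd number of odd faces, so a
  -- join of the odd faces must leave this set, and it can only do so through a vertex of C.
  oddCycle-touched : ∀ J → IsJoin oddFace J → ∀ C → OddCycle graph C → ∀ z → (∀ e → border z e ≡ edgeParity C e) →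
                     ∃ λ v → OnCycle graph C v × touched J v ≡ true
  oddCycle-touched J ∂J C oddC z z≡c =
    let e , crossing , v∈S = separated J (sym (·-boundary z J) ∙
          (·-cong (λ _ → refl) ∂J ∙ (·-oddFace z ∙ (·-cong z≡c (λ _ → refl) ∙ c·odd))))
    in L.via e , meets (L.via e) (L.left e) (L.right e) (L.on-left e) (L.on-right e) crossing , v∈S
    where
    open Cycle C

    c·odd : edgeParity C · odd ≡ true
    c·odd = edgeParity-· C odd ∙ (sym (odd?-countF (odd ∘ es)) ∙ IsOdd⇒odd? (countF (odd ∘ es)) oddC)

    separated : ∀ J → xorSum (λ e → z (L.left e) xor z (L.right e)) J ≡ true →
                ∃ λ (e : Link) → z (L.left e) xor z (L.right e) ≡ true × touched J (L.via e) ≡ true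
    separated (e ∷ J) h with z (L.left e) xor z (L.right e) in eq
    ... | true = e , eq , cong (_∨ touched J (L.via e)) (δ-refl (L.via e))
    ... | false = let e' , p , q = separated J h in e' , p , cong (δ (L.via e') (L.via e) ∨_) q ∙ ∨-zeroʳ _

    endpoints : ∀ i b → OnCycle graph C (end (es i) b)
    endpoints i b with join i
    endpoints i false | inj₁ (p , q) = _ , sym p
    endpoints i true  | inj₁ (p , q) = _ , sym q
    endpoints i false | inj₂ (p , q) = _ , sym p
    endpoints i true  | inj₂ (p , q) = _ , sym q

    onCycle? : ∀ v → Dec (OnCycle graph C v)
    onCycle? v = any? λ i → vs i ≟ v

    -- No edge at a vertex off the cycle belongs to the cycle, so z does not change in the rotation
    -- around such a vertex.
    meets : ∀ v f g → OnBoundary f v → OnBoundary g v → z f xor z g ≡ true → OnCycle graph C v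
    meets v f g f∋v g∋v differ with onCycle? v
    ... | yes on = on
    ... | no off = ⊥-elim (true≢false differ (cong (_xor z g) (same f∋v g∋v) ∙ xor-same (z g)))
      where
      off-edge : ∀ e b → end e b ≡ v → edgeParity C e ≡ false
      off-edge e b p = sum-zero λ i → δ-≢ λ { refl → off (subst (OnCycle graph C) p (endpoints i b)) }
      agree : ∀ d → tail d ≡ v → z (faceOfDart d) ≡ z (faceOfDart (α d))
      agree (e , false) p = xor-cancel (z≡c e ∙ off-edge e false p)
      agree (e , true) p = sym (xor-cancel (z≡c e ∙ off-edge e true p))
      same : OnBoundary f v → OnBoundary g v → z f ≡ z g
      same (inj₁ (d , refl , p)) (inj₁ (d' , refl , p')) = around z v agree d d' p p'
      same (inj₁ (d , _ , p)) (inj₂ (iso , _)) = ⊥-elim (isolated⇒no-dart v iso d p)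
      same (inj₂ (iso , _)) (inj₁ (d , _ , p)) = ⊥-elim (isolated⇒no-dart v iso d p)
      same (inj₂ (_ , p)) (inj₂ (_ , q)) = cong z (sym p ∙ q)

  transversal : ∀ J → IsJoin oddFace J → IsTransversal graph (touched J)
  transversal J ∂J C oddC =
    -- Any face can serve as `f₀`; an edge of the cycle provides one.
    let z , p = cycle⇒border (left (Cycle.es C zero)) (edgeParity C)
                  (λ x → edgeParity-· C (coboundary x) ∙ parity-cycle graph C x)
    in oddCycle-touched J ∂J C oddC z p

  -- The border of `Z` is even at every vertex and, by `·-oddFace`, has an odd number of odd edges.
  -- A cycle inside it passes only through ends of border edges, and the two faces of such an edge
  -- lie on different sides of `Z`.
  oddCycleAround : ∀ Z → Z · oddFace ≡ true →
                   ∃ λ C → OddCycle graph C × ∀ v → OnCycle graph C v → Crosses Z v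
  oddCycleAround Z oddZ =
    let C , oddC , on = evenEdgeSet⇒oddCycle graph (border Z) 
                         (λ v → border⊥coboundary Z (δ v)) (sym (·-oddFace Z) ∙ oddZ)
    in C , oddC , λ { v (i , refl) → cross C i (on i) }
    where
    differ : ∀ {a b} → a xor b ≡ true → a ≢ b
    differ {a} p refl = true≢false p (xor-same a)
    cross : ∀ C i → border Z (Cycle.es C i) ≡ true → Crosses Z (Cycle.vs C i)
    cross C i on with Cycle.join C i
    ... | inj₁ (p , _) = subst (Crosses Z) p (left e , right e , tail-left e false , tail-right e false , differ on)
      where e = Cycle.es C i
    ... | inj₂ (_ , p) = subst (Crosses Z) p (left e , right e , tail-right e true , tail-left e true , differ on)
      where e = Cycle.es C i

  deadPacking : ∀ deadly {s} → Packing oddFace deadly s → ∃ λ P → DeadPacking.size {deadly = deadly} P ≡ s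
  deadPacking deadly {s} P = record
    { size = s
    ; cyc = λ i → proj₁ (around-cut i)
    ; cycOdd = λ i → proj₁ (proj₂ (around-cut i))
    ; disjoint = λ i j i≢j v on on' →
        disjoint i j i≢j v (proj₂ (proj₂ (around-cut i)) v on) (proj₂ (proj₂ (around-cut j)) v on')
    ; avoid = λ i f dead v on bd → avoid i f v dead bd (proj₂ (proj₂ (around-cut i)) v on)
    } , refl
    where
    open Packing P
    around-cut = λ i → oddCycleAround (cut i) (cut-odd i)

theorem7 : (G : PlaneSignedGraph) → (deadly : Fin (PlaneSignedGraph.F G) → Bool) →
    (∃ λ f → PlaneSignedGraph.OddFace G f) →
    (∀ f → PlaneSignedGraph.OddFace G f → deadly f ≡ true) →
    ∀ (t ν : ℕ) → IsTau (PlaneSignedGraph.graph G) t → PlaneSignedGraph.IsNuDead G deadly ν →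
    t + 2 ≤ ν + 2 * countF deadly
theorem7 G deadly (f , oddf) odd⇒deadly t ν (_ , t-min) (_ , ν-max) =
  bound F n (countF deadly + length J) OnBoundary onBoundary? oddFace deadly
    (λ f odd → odd⇒deadly f (odd?⇒IsOdd (oddOnBoundary f) odd)) (f , odd⇒deadly f oddf)
    J ∂J ≤-refl t ν
    (λ J ∂J → ≤-trans (t-min (touched J) (transversal J ∂J)) (touched-size J))
    (λ s P → let Q , size≡s = deadPacking deadly P in subst (_≤ ν) size≡s (ν-max Q))
  where
  open PlaneSignedGraph G
  open Assembly G
  open Induction
  J = proj₁ initialJoin
  ∂J = proj₂ initialJoin
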